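{- For every $\epsilon > 0$ there is some $n_0 = n_0(\epsilon)$ such that for every $n > n_0$, every proper edge coloring of the complete graph $K_n$ contains a rainbow path on at least $(3/4 - \epsilon)n$ vertices.
   Context: A proper edge coloring of a graph $G=(V,E)$ is a map $c\colon E\to \mathbb{N}$ such that any two distinct edges sharing an endpoint receive different colors. A subgraph (e.g. a path) is rainbow if no two of its edges receive the same color. -}

module Defs where

open import Data.Nat using (ℕ; suc)
open import Data.Fin using (Fin)
open import Data.List using (List; []; _∷_; length)
open import Data.List.Relation.Unary.Unique.Propositional using (Unique)
open import Data.Product using (_×_; Σ)
open import Relation.Binary.PropositionalEquality using (_≡_; _≢_)

-- An edge coloring of the complete graph K_n on vertex set Fin n with colors in ℕ,
-- represented by a function on ordered pairs; only values on pairs u ≢ v matter.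
-- It must be symmetric (edges are unordered) and proper.
IsEdgeColoring : (n : ℕ) → (Fin n → Fin n → ℕ) → Set
IsEdgeColoring n c = ∀ u v → u ≢ v → c u v ≡ c v u

IsProper : (n : ℕ) → (Fin n → Fin n → ℕ) → Set
IsProper n c = ∀ u v w → u ≢ v → u ≢ w → v ≢ w → c u v ≢ c u w

edgeColors : {n : ℕ} → (Fin n → Fin n → ℕ) → List (Fin n) → List ℕ
edgeColors c [] = []
edgeColors c (x ∷ []) = []
edgeColors c (x ∷ y ∷ xs) = c x y ∷ edgeColors c (y ∷ xs)

-- A path in K_n: a sequence of pairwise distinct vertices (every pair is adjacent).
-- It is rainbow if its edge colors are pairwise distinct.
IsRainbowPath : {n : ℕ} → (Fin n → Fin n → ℕ) → List (Fin n) → Set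
IsRainbowPath c p = Unique p × Unique (edgeColors c p)

{-# OPTIONS --safe #-}
module Submission where

open import Defs

-- There is a rainbow linear forest with o(n) components covering all vertices.  Its components are
-- absorbed into one of its paths P.  While P has fewer than 3n/4 vertices, every vertex has at least n/4
-- neighbours in colours not on P, which leaves enough room to splice a piece of another component of
-- about average length into P, at the cost of boundedly many vertices of P and boundedly many extra
-- components.  Hence P grows by a fixed fraction of n before the number of components doubles, and a
-- bounded number of doublings takes P to 3n/4 vertices.

-- Let `k` vertices lie on P and `f` outside it. P uses fewer than `k` colours, so every vertex has
-- about `f` edges in other colours. As long as `k < 3f`, five such neighbourhoods, of total size
-- about 5f, sit among fewer than 4f vertices, and two of them must overlap in a positive fraction
-- of `f`; this is the room for reconnecting P. The obstacle is that a connecting edge may repeat a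
-- colour of another path. That colour is then cut away there, so every step leaves more paths
-- behind. A spliced piece must fit into these paths, so the gain per step is halved whenever their
-- number may have doubled. Each phase between two halvings still gains n/1024 vertices, so 1024
-- phases suffice, and the initial forest is made to have at most n/K components for a constant K of
-- order 2^1024 that pays for all the halvings in advance.

module LongRainbowPath where

  open import Data.Nat
  open import Data.Nat.Properties
  open import Data.Nat.DivMod using (m/n*n≤m; m≡m%n+[m/n]*n; m%n<n)
  open import Data.Nat.ListAction using (sum)
  open import Data.Nat.Tactic.RingSolver using (solve-∀)
  open import Data.Fin using (Fin)
  open import Data.Fin.Properties using () renaming (_≟_ to _≟ᶠ_)
  open import Data.List hiding (lookup; sum; find)
  open import Data.List.Properties
  open import Data.List.Membership.Propositional using (_∈_; _∉_; mapWith∈; find)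
  open import Data.List.Membership.Propositional.Properties
  open import Data.List.Membership.DecPropositional using () renaming (_∈?_ to mem?)
  open import Data.List.Relation.Unary.Any as Any using (Any; here; there; any?)
  open import Data.List.Relation.Unary.All as All using (All; []; _∷_)
  import Data.List.Relation.Unary.All.Properties as AllP
  open import Data.List.Relation.Unary.AllPairs using ([]; _∷_)
  open import Data.List.Relation.Unary.Unique.Propositional using (Unique)
  import Data.List.Relation.Unary.Unique.Propositional.Properties as UniqueP
  open import Data.List.Relation.Binary.Sublist.Propositional using (_⊆_; []; _∷_; ⊆-trans; from∈)
    renaming (_∷ʳ_ to _∷ˢ_)
  open import Data.List.Relation.Binary.Sublist.Propositional.Properties as SubP
    using (All-resp-⊆; Any-resp-⊆; filter-⊆; take-⊆)
  import Data.List.Relation.Binary.Sublist.Heterogeneous.Properties as SubH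
  open import Data.List.Relation.Binary.Permutation.Propositional
    using (_↭_; refl; prep; swap; ↭-sym; ↭-trans; ↭-reflexive; ↭-prep; ↭⇒↭ₛ)
  open import Data.List.Relation.Binary.Permutation.Propositional.Properties as PermP
    using (∈-resp-↭; ↭-length; shift; shifts; drop-∷)
  import Data.List.Relation.Binary.Permutation.Setoid.Properties as PermS
  open import Data.Product using (_×_; _,_; Σ; ∃; ∃₂; proj₁; proj₂; uncurry)
  open import Data.Sum using (_⊎_; inj₁; inj₂; [_,_]′)
  open import Data.Empty using (⊥; ⊥-elim)
  open import Function using (_∘_; id)
  open import Relation.Nullary using (¬_; Dec; yes; no)
  open import Relation.Nullary.Decidable using (_×-dec_; _⊎-dec_; ¬?)
  open import Relation.Unary using (Decidable)
  open import Relation.Binary.PropositionalEquality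
    using (_≡_; _≢_; refl; trans; sym; cong; cong₂; subst; subst₂; setoid)
  import Data.Integer as ℤ
  import Data.Integer.Properties as ℤP
  import Data.Rational as ℚ
  import Data.Rational.Properties as ℚP
  import Data.Rational.Unnormalised as ℚᵘ
  import Data.Rational.Unnormalised.Properties as ℚᵘP

  -- Farkas-style certificate for linear arithmetic: s is the slack.
  linear : ∀ {a b x y} s → a ≤ b → x + b + s ≡ y + a → x ≤ y
  linear {a} {b} {x} {y} s a≤b eq = +-cancelʳ-≤ b x y
    (≤-trans (m≤m+n (x + b) s) (≤-trans (≤-reflexive eq) (+-monoʳ-≤ y a≤b)))

  left-comm : ∀ a b c → a + (b + c) ≡ b + (a + c)
  left-comm = solve-∀

  -- Counting and averaging in lists.

  module _ {A B : Set} (R : A → B → Set) where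

    matching-length : ∀ {xs ys} → Unique xs →
      (∀ {x} → x ∈ xs → ∃ λ y → y ∈ ys × R x y) →
      (∀ {x x′ y} → x ∈ xs → x′ ∈ xs → R x y → R x′ y → x ≡ x′) →
      length xs ≤ length ys
    matching-length [] _ _ = z≤n
    matching-length {x ∷ xs} (x∉ ∷ uxs) match inj with match (here refl)
    ... | y , y∈ , rxy with ∈-∃++ y∈
    ... | as , bs , refl = subst (suc (length xs) ≤_) (sym (length-++-sucʳ as y bs))
        (s≤s (matching-length uxs match′ λ p q → inj (there p) (there q)))
      where
      match′ : ∀ {x′} → x′ ∈ xs → ∃ λ z → z ∈ as ++ bs × R x′ z
      match′ x′∈ with match (there x′∈)
      ... | z , z∈ , rx′z with ∈-++⁻ as z∈
      ... | inj₁ z∈as = z , ∈-++⁺ˡ z∈as , rx′z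
      ... | inj₂ (there z∈bs) = z , ∈-++⁺ʳ as z∈bs , rx′z
      ... | inj₂ (here refl) = ⊥-elim (All.lookup x∉ x′∈ (inj (here refl) (there x′∈) rxy rx′z))

  injective-length : ∀ {A B : Set} (f : A → B) {xs ys} → Unique xs →
    (∀ {x} → x ∈ xs → f x ∈ ys) →
    (∀ {x x′} → x ∈ xs → x′ ∈ xs → f x ≡ f x′ → x ≡ x′) →
    length xs ≤ length ys
  injective-length f uxs mem inj = matching-length (λ x y → f x ≡ y) uxs
    (λ x∈ → f _ , mem x∈ , refl) (λ p q e e′ → inj p q (trans e (sym e′)))

  unique-length : ∀ {A : Set} {xs ys : List A} → Unique xs → (∀ {x} → x ∈ xs → x ∈ ys) → length xs ≤ length ys
  unique-length uxs mem = injective-length id uxs mem (λ _ _ e → e)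

  Unique-++⁻ : ∀ {A : Set} (xs : List A) {ys} → Unique (xs ++ ys) →
    Unique xs × Unique ys × (∀ {x} → x ∈ xs → x ∉ ys)
  Unique-++⁻ [] u = [] , u , λ ()
  Unique-++⁻ (x ∷ xs) (x∉ ∷ u) with Unique-++⁻ xs u | AllP.++⁻ xs x∉
  ... | uxs , uys , dis | a , b = (a ∷ uxs) , uys , λ
    { (here refl) q → All.lookup b q refl ; (there p) → dis p }

  Unique-⊆ : ∀ {A : Set} {xs ys : List A} → xs ⊆ ys → Unique ys → Unique xs
  Unique-⊆ [] u = u
  Unique-⊆ (y ∷ˢ s) (_ ∷ u) = Unique-⊆ s u
  Unique-⊆ (refl ∷ s) (x∉ ∷ u) = All-resp-⊆ s x∉ ∷ Unique-⊆ s u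

  ⊆-∃++ : ∀ {A : Set} {x : A} {xs ys} → x ∷ xs ⊆ ys → ∃₂ λ as bs → ys ≡ as ++ x ∷ bs × xs ⊆ bs
  ⊆-∃++ (y ∷ˢ s) with ⊆-∃++ s
  ... | as , bs , refl , s′ = y ∷ as , bs , refl , s′
  ⊆-∃++ (refl ∷ s) = [] , _ , refl , s

  module _ {A : Set} where

    count : {P : A → Set} → Decidable P → List A → ℕ
    count P? xs = length (filter P? xs)

    module _ {P : A → Set} (P? : Decidable P) where

      count-++ : ∀ xs ys → count P? (xs ++ ys) ≡ count P? xs + count P? ys
      count-++ xs ys = trans (cong length (filter-++ P? xs ys)) (length-++ (filter P? xs))

      count-¬ : ∀ xs → count P? xs + count (¬? ∘ P?) xs ≡ length xs
      count-¬ [] = refl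
      count-¬ (x ∷ xs) with P? x
      ... | yes p = cong suc (count-¬ xs)
      ... | no ¬p = trans (+-suc _ _) (cong suc (count-¬ xs))

      count>0 : ∀ xs → 0 < count P? xs → ∃ λ x → x ∈ xs × P x
      count>0 xs 0<c with filter P? xs in eq
      ... | x ∷ _ = x , ∈-filter⁻ P? (subst (x ∈_) (sym eq) (here refl))

      module _ {Q : A → Set} (Q? : Decidable Q) where

        count-∪∩ : ∀ xs → count (λ x → P? x ⊎-dec Q? x) xs + count (λ x → P? x ×-dec Q? x) xs
          ≡ count P? xs + count Q? xs
        count-∪∩ [] = refl
        count-∪∩ (x ∷ xs) with P? x | Q? x
        ... | yes p | yes q = cong suc (trans (+-suc _ _) (trans (cong suc (count-∪∩ xs)) (sym (+-suc _ _))))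
        ... | yes p | no ¬q = cong suc (count-∪∩ xs)
        ... | no ¬p | yes q = trans (cong suc (count-∪∩ xs)) (sym (+-suc _ _))
        ... | no ¬p | no ¬q = count-∪∩ xs

    count-⇒ : {P Q : A → Set} (P? : Decidable P) (Q? : Decidable Q) →
      (∀ {x} → P x → Q x) → ∀ xs → count P? xs ≤ count Q? xs
    count-⇒ P? Q? f [] = z≤n
    count-⇒ P? Q? f (x ∷ xs) with P? x | Q? x
    ... | yes p | yes q = s≤s (count-⇒ P? Q? f xs)
    ... | yes p | no ¬q = ⊥-elim (¬q (f p))
    ... | no ¬p | yes q = m≤n⇒m≤1+n (count-⇒ P? Q? f xs)
    ... | no ¬p | no ¬q = count-⇒ P? Q? f xs

    module _ {P : A → Set} (P? : Decidable P) where

      private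
        sublist : ∀ m ys → m ≤ count P? ys → ∃ λ us → us ⊆ ys × length us ≡ m × All P us
        sublist m ys m≤c = take m (filter P? ys) , ⊆-trans (take-⊆ m _) (filter-⊆ P? ys) ,
          trans (length-take m _) (m≤n⇒m⊓n≡m m≤c) , AllP.take⁺ m (AllP.all-filter P? ys)

      -- Pigeonhole over consecutive blocks of length `w`: a block with at most `m` hits lowers the
      -- left side by `m * w` and the right side by no more than that, so it may be cut off and the
      -- inequality survives. The extra `w` pays for a last block that is too short.
      cluster : ∀ m w xs → m * (length xs + w) < count P? xs * w →
        ∃₂ λ ls ms → ∃₂ λ rs us → xs ≡ ls ++ ms ++ rs × length ms ≤ w ×
          us ⊆ ms × length us ≡ suc m × All P us
      cluster m w xs = go (length xs) xs ≤-refl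
        where
        go : ∀ k xs → length xs ≤ k → m * (length xs + w) < count P? xs * w →
          ∃₂ λ ls ms → ∃₂ λ rs us → xs ≡ ls ++ ms ++ rs × length ms ≤ w ×
            us ⊆ ms × length us ≡ suc m × All P us
        go k xs ≤k h with length xs ≤? w
        ... | yes ≤w with sublist (suc m) xs
                   (*-cancelʳ-< w m _ (≤-<-trans (*-monoʳ-≤ m (m≤n+m w (length xs))) h))
        ...   | us , s , l , a = [] , xs , [] , us , sym (++-identityʳ xs) , ≤w , s , l , a
        go zero xs ≤k h | no ≰w = ⊥-elim (≰w (≤-trans ≤k z≤n))
        go (suc k) xs ≤k h | no ≰w with suc m ≤? count P? (take w xs)
        ... | yes c with sublist (suc m) (take w xs) c
        ...   | us , s , l , a = [] , take w xs , drop w xs , us , sym (take++drop≡id w xs) ,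
                ≤-trans (≤-reflexive (length-take w xs)) (m⊓n≤m w _) , s , l , a
        go (suc k) xs ≤k h | no ≰w | no ≰c
          with go k (drop w xs)
            (≤-pred (≤-trans shorter ≤k))
            h′
          where
          0<w : 0 < w
          0<w = n≢0⇒n>0 λ { refl → n≮0 (subst (m * (length xs + 0) <_) (*-zeroʳ (count P? xs)) h) }
          w≤ : w ≤ length xs
          w≤ = <⇒≤ (≰⇒> ≰w)
          len : length (drop w xs) + w ≡ length xs
          len = trans (cong (_+ w) (length-drop w xs)) (m∸n+n≡m w≤)
          shorter : length (drop w xs) < length xs
          shorter = subst (length (drop w xs) <_) len (m<m+n _ 0<w)
          cnt : count P? xs ≡ count P? (take w xs) + count P? (drop w xs)
          cnt = trans (cong (count P?) (sym (take++drop≡id w xs))) (count-++ P? (take w xs) (drop w xs))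
          h′ : m * (length (drop w xs) + w) < count P? (drop w xs) * w
          h′ = +-cancelˡ-< (m * w) _ _ (≤-trans (≤-trans (≤-reflexive (cong suc e₁)) h)
            (≤-trans (≤-reflexive e₂) (+-monoˡ-≤ _ (*-monoˡ-≤ w (≤-pred (≰⇒> ≰c))))))
            where
            e₁ : m * w + m * (length (drop w xs) + w) ≡ m * (length xs + w)
            e₁ = trans (sym (*-distribˡ-+ m w _)) (cong (m *_) (trans (+-comm w _) (cong (_+ w) len)))
            e₂ : count P? xs * w ≡ count P? (take w xs) * w + count P? (drop w xs) * w
            e₂ = trans (cong (_* w) cnt) (*-distribʳ-+ w (count P? (take w xs)) _)
        ... | ls , ms , rs , us , eq , rest = take w xs ++ ls , ms , rs , us ,
              trans (sym (take++drop≡id w xs)) (trans (cong (take w xs ++_) eq) (sym (++-assoc (take w xs) ls _))) , rest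

  -- bad v is the support of row v of an incidence matrix; light-column averages over the columns in S.
  module _ {A B : Set} (_∈?_ : ∀ (b : B) bs → Dec (b ∈ bs)) where

    private
      weight : (A → List B) → List A → B → ℕ
      weight bad ws s = count (λ v → s ∈? bad v) ws

      light : (f : B → ℕ) (S : List B) → 0 < length S →
        ∃ λ s → s ∈ S × f s * length S ≤ sum (map f S)
      light f (s ∷ []) _ = s , here refl , ≤-reflexive (trans (*-identityʳ _) (sym (+-identityʳ _)))
      light f (s ∷ S@(_ ∷ _)) _ with light f S (s≤s z≤n)
      ... | s′ , s′∈ , le with ≤-total (f s) (f s′)
      ... | inj₁ a = s , here refl , ≤-trans (≤-reflexive (*-suc (f s) (length S)))
                       (+-monoʳ-≤ (f s) (≤-trans (*-monoˡ-≤ (length S) a) le))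
      ... | inj₂ a = s′ , there s′∈ , ≤-trans (≤-reflexive (*-suc (f s′) (length S))) (+-mono-≤ a le)

      total : ∀ (bad : A → List B) m ws S → Unique S → (∀ {v} → v ∈ ws → length (bad v) ≤ m) →
        sum (map (weight bad ws) S) ≤ length ws * m
      total bad m [] S uS h = ≤-reflexive (zeros S)
        where
        zeros : ∀ S → sum (map (λ _ → 0) S) ≡ 0
        zeros [] = refl
        zeros (_ ∷ S) = zeros S
      total bad m (v ∷ ws) S uS h = ≤-trans (≤-reflexive (split S)) (+-mono-≤
        (≤-trans (unique-length (UniqueP.filter⁺ (_∈? bad v) uS)
          (λ {x} x∈ → proj₂ (∈-filter⁻ (_∈? bad v) {xs = S} x∈))) (h (here refl)))
        (total bad m ws S uS (h ∘ there)))
        where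
        split : ∀ S → sum (map (weight bad (v ∷ ws)) S)
          ≡ count (_∈? bad v) S + sum (map (weight bad ws) S)
        split [] = refl
        split (s ∷ S) with s ∈? bad v
        ... | yes _ = cong suc (trans (cong (weight bad ws s +_) (split S)) (left-comm (weight bad ws s) (count (_∈? bad v) S) (sum (map (weight bad ws) S))))
        ... | no _ = trans (cong (weight bad ws s +_) (split S)) (left-comm (weight bad ws s) (count (_∈? bad v) S) (sum (map (weight bad ws) S)))

    light-column : ∀ (bad : A → List B) m ws S → 0 < length S → Unique S →
      (∀ {v} → v ∈ ws → length (bad v) ≤ m) →
      ∃ λ s → s ∈ S × count (λ v → s ∈? bad v) ws * length S ≤ length ws * m
    light-column bad m ws S 0<S uS h with light (weight bad ws) S 0<S
    ... | s , s∈ , le = s , s∈ , ≤-trans le (total bad m ws S uS h)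

  module _ {A B : Set} (N : A → B → Set) (N? : ∀ a b → Dec (N a b)) (ys : List B) (ν τ : ℕ) where

    private
      U? : ∀ us → Decidable (λ y → Any (λ a → N a y) us)
      U? us y = any? (λ a → N? a y) us

      cons-count : ∀ a us → count (N? a) ys + count (U? us) ys
        ≤ count (U? (a ∷ us)) ys + count (λ y → N? a y ×-dec U? us y) ys
      cons-count a us = ≤-trans (≤-reflexive (sym (count-∪∩ (N? a) (U? us) ys)))
        (+-monoˡ-≤ _ (count-⇒ (λ y → N? a y ⊎-dec U? us y) (U? (a ∷ us))
          (λ { (inj₁ p) → here p ; (inj₂ q) → there q }) ys))

      meets : ∀ a us →
        (∃ λ b → b ∈ us × τ < count (λ y → N? a y ×-dec N? b y) ys)
        ⊎ (count (λ y → N? a y ×-dec U? us y) ys ≤ length us * τ)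
      meets a [] = inj₂ (≤-trans (count-⇒ (λ y → N? a y ×-dec U? [] y) (λ _ → no λ ()) (λ { (_ , ()) }) ys)
        (≤-reflexive (none ys)))
        where
        none : ∀ (ys : List B) → count {P = λ _ → ⊥} (λ _ → no λ ()) ys ≡ 0
        none [] = refl
        none (_ ∷ ys) = none ys
      meets a (b ∷ us) with τ <? count (λ y → N? a y ×-dec N? b y) ys | meets a us
      ... | yes h | _ = inj₁ (b , here refl , h)
      ... | no _ | inj₁ (b′ , b′∈ , h) = inj₁ (b′ , there b′∈ , h)
      ... | no h | inj₂ le = inj₂ (≤-trans
        (count-⇒ (λ y → N? a y ×-dec U? (b ∷ us) y)
          (λ y → (N? a y ×-dec N? b y) ⊎-dec (N? a y ×-dec U? us y))
          (λ { (p , here q) → inj₁ (p , q) ; (p , there q) → inj₂ (p , q) }) ys)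
        (≤-trans (≤-trans (m≤m+n _ _) (≤-reflexive (count-∪∩ (λ y → N? a y ×-dec N? b y) (λ y → N? a y ×-dec U? us y) ys)))
          (+-mono-≤ (≮⇒≥ h) le)))

      -- Bonferroni: if no two sets meet in more than `τ` elements, each set contributes at least
      -- `ν` minus `τ` for every set already counted. The number of pairs is relaxed to the square
      -- of the number of sets.
      union : ∀ us → (∀ {a} → a ∈ us → ν ≤ count (N? a) ys) →
        (∃₂ λ a b → a ∷ b ∷ [] ⊆ us × τ < count (λ y → N? a y ×-dec N? b y) ys)
        ⊎ (length us * ν ≤ count (U? us) ys + length us * length us * τ)
      union [] h = inj₂ z≤n
      union (a ∷ us) h with meets a us | union us (h ∘ there)
      ... | inj₁ (b , b∈ , lt) | _ = inj₁ (a , b , refl ∷ from∈ b∈ , lt)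
      ... | inj₂ _ | inj₁ (a′ , b , s , lt) = inj₁ (a′ , b , a ∷ˢ s , lt)
      ... | inj₂ le | inj₂ ih = inj₂ (arith (length us) (h (here refl)) (cons-count a us) le ih)
        where
        arith : ∀ m {c u i d} → ν ≤ c → c + u ≤ d + i → i ≤ m * τ → m * ν ≤ u + m * m * τ →
          suc m * ν ≤ d + suc m * suc m * τ
        arith m {c} {u} {i} {d} h₁ h₂ h₃ h₄ =
          linear (m * τ + τ)
            (+-mono-≤ (+-mono-≤ h₁ h₂) (+-mono-≤ h₃ h₄)) (eq m ν c u i d τ)
          where
          eq : ∀ m ν c u i d τ → suc m * ν + (c + (d + i) + (m * τ + (u + m * m * τ))) + (m * τ + τ)
            ≡ d + suc m * suc m * τ + (ν + (c + u) + (i + m * ν))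
          eq = solve-∀

    two-meet : ∀ us → (∀ {a} → a ∈ us → ν ≤ count (N? a) ys) →
      length ys + length us * length us * τ < length us * ν →
      ∃₂ λ a b → a ∷ b ∷ [] ⊆ us × τ < count (λ y → N? a y ×-dec N? b y) ys
    two-meet us h big with union us h
    ... | inj₁ found = found
    ... | inj₂ le = ⊥-elim (<⇒≱ big (≤-trans le (+-monoˡ-≤ _ (length-filter (U? us) ys))))

  -- Linear forests with few components.

  Unique-↭ : ∀ {A : Set} {xs ys : List A} → xs ↭ ys → Unique xs → Unique ys
  Unique-↭ {A} p = PermS.Unique-resp-↭ (setoid A) (↭⇒↭ₛ p)

  concatMap-↭ : ∀ {A B : Set} (f : A → List B) {xs ys} → xs ↭ ys → concatMap f xs ↭ concatMap f ys
  concatMap-↭ f refl = refl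
  concatMap-↭ f (prep x p) = PermP.++⁺ˡ (f x) (concatMap-↭ f p)
  concatMap-↭ f (swap x y p) = ↭-trans (shifts (f x) (f y)) (PermP.++⁺ˡ (f y) (PermP.++⁺ˡ (f x) (concatMap-↭ f p)))
  concatMap-↭ f (_↭_.trans p q) = ↭-trans (concatMap-↭ f p) (concatMap-↭ f q)

  ∈-∃↭ : ∀ {A : Set} {x : A} {xs} → x ∈ xs → ∃ λ ys → xs ↭ x ∷ ys
  ∈-∃↭ {x = x} x∈ with ∈-∃++ x∈
  ... | as , bs , refl = as ++ bs , shift x as bs

  map-injectiveOn : ∀ {A B : Set} (f : A → B) {xs} → Unique (map f xs) →
    ∀ {x y} → x ∈ xs → y ∈ xs → f x ≡ f y → x ≡ y
  map-injectiveOn f u (here refl) (here refl) e = refl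
  map-injectiveOn f (x∉ ∷ u) (here refl) (there q) e = ⊥-elim (All.lookup x∉ (∈-map⁺ f q) e)
  map-injectiveOn f (x∉ ∷ u) (there p) (here refl) e = ⊥-elim (All.lookup x∉ (∈-map⁺ f p) (sym e))
  map-injectiveOn f (_ ∷ u) (there p) (there q) e = map-injectiveOn f u p q e

  module _ {A : Set} where

    -- A component is a head followed by a list, hence never empty: it always has a first vertex
    -- and, through `end`, a last one.
    Chain : Set
    Chain = A × List A

    vertices : List Chain → List A
    vertices = concatMap (uncurry _∷_)

    steps : A → List A → List (A × A)
    steps x [] = []
    steps x (y ∷ ys) = (x , y) ∷ steps y ys

    arcs : List Chain → List (A × A)
    arcs = concatMap (uncurry steps)

    end : A → List A → A
    end x [] = x
    end x (y ∷ ys) = end y ys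

    end∈ : ∀ x xs → end x xs ∈ x ∷ xs
    end∈ x [] = here refl
    end∈ x (y ∷ ys) = there (end∈ y ys)

    end-++ : ∀ x xs y ys → end x (xs ++ y ∷ ys) ≡ end y ys
    end-++ x [] y ys = refl
    end-++ x (z ∷ xs) y ys = end-++ z xs y ys

    steps-++ : ∀ x xs y ys → steps x (xs ++ y ∷ ys) ≡ steps x xs ++ (end x xs , y) ∷ steps y ys
    steps-++ x [] y ys = refl
    steps-++ x (z ∷ xs) y ys = cong (_ ∷_) (steps-++ z xs y ys)

    vertices-↭ : ∀ {F G} → F ↭ G → vertices F ↭ vertices G
    vertices-↭ = concatMap-↭ (uncurry _∷_)

    arcs-↭ : ∀ {F G} → F ↭ G → arcs F ↭ arcs G
    arcs-↭ = concatMap-↭ (uncurry steps)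

    steps-split : ∀ x xs {a b} → (a , b) ∈ steps x xs → ∃₂ λ us vs → xs ≡ us ++ b ∷ vs × end x us ≡ a
    steps-split x (y ∷ ys) (here refl) = [] , ys , refl , refl
    steps-split x (y ∷ ys) (there p) with steps-split y ys p
    ... | us , vs , refl , e = y ∷ us , vs , refl , e

    steps-tails : ∀ x xs → map proj₁ (steps x xs) ++ end x xs ∷ [] ≡ x ∷ xs
    steps-tails x [] = refl
    steps-tails x (y ∷ ys) = cong (x ∷_) (steps-tails y ys)

    -- Every vertex but the last of its component is the tail of exactly one arc. In a forest with
    -- distinct vertices, the ends and the tails of arcs are therefore all distinct, which is what
    -- the counting of free vertices rests on.
    tails-ends : ∀ F → vertices F ↭ map (uncurry end) F ++ map proj₁ (arcs F)
    tails-ends [] = refl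
    tails-ends ((x , xs) ∷ F) = ↭-trans
      (PermP.++⁺ (↭-trans (↭-reflexive (sym (steps-tails x xs))) (PermP.++-comm (map proj₁ (steps x xs)) _)) (tails-ends F))
      (↭-prep (end x xs) (↭-trans (shifts (map proj₁ (steps x xs)) (map (uncurry end) F))
        (PermP.++⁺ˡ (map (uncurry end) F) (↭-reflexive (sym (map-++ proj₁ (steps x xs) (arcs F)))))))

    heads-⊆ : ∀ F → map proj₁ F ⊆ vertices F
    heads-⊆ [] = []
    heads-⊆ ((x , xs) ∷ F) = refl ∷ SubH.++ˡ xs (heads-⊆ F)

  -- A rainbow linear forest with t components (t large) can be rearranged to one with fewer:
  -- moving an arc into a component's last vertex v from a head s frees the tail of the arc
  -- whose colour is c v s.  The freed tails together with the ends of components are distinct,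
  -- so the set of freed vertices grows by about t at each round.
  module Forest {n : ℕ} (c : Fin n → Fin n → ℕ)
    (c-sym : ∀ u v → c u v ≡ c v u)
    (c-inj : ∀ {u v w} → u ≢ v → u ≢ w → c u v ≡ c u w → v ≡ w) where

    private
      V = Fin n
      infix 4 _∈ᵛ?_
      _∈ᵛ?_ : ∀ (v : V) vs → Dec (v ∈ vs)
      _∈ᵛ?_ = mem? _≟ᶠ_

    colour : V × V → ℕ
    colour = uncurry c

    RainbowForest : List (Chain {V}) → Set
    RainbowForest F = Unique (vertices F) × Unique (map colour (arcs F))

    Shorter : List (Chain {V}) → Set
    Shorter F = ∃ λ G → RainbowForest G × vertices G ↭ vertices F × suc (length G) ≡ length F

    module _ (F : List (Chain {V})) (rf : RainbowForest F) where

      record Free (ℓ : ℕ) (v : V) : Set where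
        field
          x : V
          xs : List V
          rest : List (Chain {V})
          size : suc (length rest) ≡ length F
          ends-at : end x xs ≡ v
          same : vertices ((x , xs) ∷ rest) ↭ vertices F
          rainbow : Unique (map colour (arcs ((x , xs) ∷ rest)))
          added : List (V × V)
          added≤ : length added ≤ ℓ
          arcs⊆ : ∀ {e} → e ∈ arcs ((x , xs) ∷ rest) → e ∈ arcs F ⊎ e ∈ added
          used : List V
          used≤ : length used ≤ ℓ
          heads⊆ : ∀ {s} → s ∈ map proj₁ F → s ∉ used → s ∈ map proj₁ ((x , xs) ∷ rest)

      open Free

      weaken : ∀ {ℓ ℓ′ v} → ℓ ≤ ℓ′ → Free ℓ v → Free ℓ′ v
      weaken le fr = record
        { Free fr ; added≤ = ≤-trans (added≤ fr) le ; used≤ = ≤-trans (used≤ fr) le }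

      free-vertex : ∀ {ℓ v} → Free ℓ v → v ∈ vertices F
      free-vertex fr = ∈-resp-↭ (same fr)
        (∈-++⁺ˡ (subst (_∈ x fr ∷ xs fr) (ends-at fr) (end∈ (x fr) (xs fr))))

      end-free : ∀ {x xs} → (x , xs) ∈ F → Free 0 (end x xs)
      end-free {x} {xs} p with ∈-∃↭ p
      ... | rest , perm = record
        { x = x ; xs = xs ; rest = rest ; size = sym (↭-length perm) ; ends-at = refl
        ; same = vertices-↭ (↭-sym perm)
        ; rainbow = Unique-↭ (PermP.map⁺ colour (arcs-↭ perm)) (proj₂ rf)
        ; added = [] ; added≤ = z≤n ; arcs⊆ = λ e∈ → inj₁ (∈-resp-↭ (arcs-↭ (↭-sym perm)) e∈)
        ; used = [] ; used≤ = z≤n ; heads⊆ = λ s∈ _ → ∈-resp-↭ (PermP.map⁺ proj₁ perm) s∈ }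

      -- If c v s is the colour of an added arc, joining v to s frees no arc of F.
      clash? : ∀ {ℓ} (w : Σ V (Free ℓ)) s → Dec (proj₁ w ≢ s × c (proj₁ w) s ∈ map colour (added (proj₂ w)))
      clash? (v , fr) s = ¬? (v ≟ᶠ s) ×-dec mem? _≟_ (c v s) (map colour (added fr))

      -- The head `x` of the vertex's own component is excluded because joining to it would close a
      -- cycle. Colours at a vertex are distinct, so at most `ℓ` heads clash; this gives the bound
      -- 2ℓ + 1 below.
      bad : ∀ {ℓ} → Σ V (Free ℓ) → List V
      bad w = x (proj₂ w) ∷ used (proj₂ w) ++ filter (clash? w) (map proj₁ F)

      heads-unique : Unique (map proj₁ F)
      heads-unique = Unique-⊆ (heads-⊆ F) (proj₁ rf)

      bad-length : ∀ {ℓ} (w : Σ V (Free ℓ)) → length (bad w) ≤ suc (ℓ + ℓ)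
      bad-length w@(v , fr) = s≤s (≤-trans (≤-reflexive (length-++ (used fr)))
        (+-mono-≤ (used≤ fr) (≤-trans
          (injective-length (c v) (UniqueP.filter⁺ (clash? w) heads-unique)
            (λ p → proj₂ (proj₂ (∈-filter⁻ (clash? w) {xs = map proj₁ F} p)))
            (λ p q e → c-inj (proj₁ (proj₂ (∈-filter⁻ (clash? w) {xs = map proj₁ F} p)))
                             (proj₁ (proj₂ (∈-filter⁻ (clash? w) {xs = map proj₁ F} q))) e))
          (≤-trans (≤-reflexive (length-map colour (added fr))) (added≤ fr)))))

      Freed : ℕ → V → V → V → Set
      Freed ℓ v s a = v ≢ s × (∃ λ b → (a , b) ∈ arcs F × c a b ≡ c v s) × Free (suc ℓ) a

      -- Join `v` to `s`, the head of another component. If the colour is new, two components have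
      -- merged. Otherwise it sits on an arc of `F`, because `s` does not clash with an added one;
      -- deleting that arc restores both rainbowness and the number of components, and its tail
      -- becomes an end.
      free-next : ∀ {ℓ} (w : Σ V (Free ℓ)) {s} → s ∈ map proj₁ F → s ∉ bad w →
        Shorter F ⊎ ∃ (Freed ℓ (proj₁ w) s)
      free-next {ℓ} w@(v , fr) {s} s∈ s∉
        with heads⊆ fr s∈ (s∉ ∘ there ∘ ∈-++⁺ˡ)
      ... | here e = ⊥-elim (s∉ (here e))
      ... | there s∈rest with ∈-map⁻ proj₁ s∈rest
      ... | (.s , ys) , sys∈ , refl with ∈-∃↭ sys∈
      ... | others , perm = result
        where
        Fv = (x fr , xs fr) ∷ rest fr
        J₁ = xs fr ++ s ∷ ys
        J = (x fr , J₁) ∷ others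

        permF : Fv ↭ (x fr , xs fr) ∷ (s , ys) ∷ others
        permF = ↭-prep _ perm

        verticesJ : vertices J ↭ vertices F
        verticesJ = ↭-trans (↭-reflexive (cong (x fr ∷_) (++-assoc (xs fr) (s ∷ ys) (vertices others))))
          (↭-trans (vertices-↭ (↭-sym permF)) (same fr))

        uniqueJ : Unique (vertices J)
        uniqueJ = Unique-↭ (↭-sym verticesJ) (proj₁ rf)

        v≢s : v ≢ s
        v≢s refl = proj₂ (proj₂ (Unique-++⁻ (x fr ∷ xs fr)
            (Unique-↭ (↭-trans (↭-sym (same fr)) (vertices-↭ permF)) (proj₁ rf))))
          (subst (_∈ x fr ∷ xs fr) (ends-at fr) (end∈ (x fr) (xs fr))) (here refl)

        arcsJ : arcs J ↭ (v , s) ∷ arcs Fv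
        arcsJ = ↭-trans (↭-reflexive (trans
            (cong (_++ arcs others) (steps-++ (x fr) (xs fr) s ys))
            (++-assoc (steps (x fr) (xs fr)) ((end (x fr) (xs fr) , s) ∷ steps s ys) (arcs others))))
          (↭-trans (shift _ (steps (x fr) (xs fr)) _)
            (↭-trans (↭-reflexive (cong (λ u → (u , s) ∷ _) (ends-at fr))) (↭-prep _ (arcs-↭ (↭-sym permF)))))

        sizeJ : suc (length J) ≡ length F
        sizeJ = trans (cong suc (sym (↭-length perm))) (size fr)

        result : Shorter F ⊎ ∃ (Freed ℓ v s)
        result with mem? _≟_ (c v s) (map colour (arcs Fv))
        ... | no new = inj₁ (J , (uniqueJ , Unique-↭ (PermP.map⁺ colour (↭-sym arcsJ))
                  (All.tabulate (λ { p refl → new p }) ∷ rainbow fr)) , verticesJ , sizeJ)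
        ... | yes old with ∈-map⁻ colour old
        ... | (a , b) , ab∈ , col≡ with arcs⊆ fr ab∈
        ... | inj₂ ab∈added = ⊥-elim (s∉ (there (∈-++⁺ʳ (used fr)
                  (∈-filter⁺ (clash? w) s∈ (v≢s , subst (_∈ map colour (added fr)) (sym col≡) (∈-map⁺ colour ab∈added))))))
        ... | inj₁ ab∈F with ∈-concatMap⁻ (uncurry steps) {xs = J} (∈-resp-↭ (↭-sym arcsJ) (there ab∈))
        ... | found with find found
        ... | (y , zs) , yzs∈ , ab∈yzs with ∈-∃↭ yzs∈ | steps-split y zs ab∈yzs
        ... | K , permJ | us , vs , refl , refl = inj₂ (a , v≢s , (b , ab∈F , sym col≡) , record
          { x = y ; xs = us ; rest = (b , vs) ∷ K
          ; size = trans (cong suc (sym (↭-length permJ))) sizeJ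
          ; ends-at = refl
          ; same = ↭-trans (↭-reflexive (cong (y ∷_) (sym (++-assoc us (b ∷ vs) (vertices K)))))
                     (↭-trans (vertices-↭ (↭-sym permJ)) verticesJ)
          ; rainbow = Unique-↭ (PermP.map⁺ colour arcsFv↭)
              (subst (λ k → Unique (k ∷ map colour (proj₁ split))) (sym col≡)
                (Unique-↭ (PermP.map⁺ colour (proj₂ split)) (rainbow fr)))
          ; added = (v , s) ∷ added fr ; added≤ = s≤s (added≤ fr)
          ; arcs⊆ = λ e∈ → classify (∈-resp-↭ (↭-sym arcsFv↭) e∈)
          ; used = s ∷ used fr ; used≤ = s≤s (used≤ fr)
          ; heads⊆ = λ s′∈ s′∉ → headsOK (heads⊆ fr s′∈ (s′∉ ∘ there)) (s′∉ ∘ here) })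
          where
          arcsK : arcs J ↭ (a , b) ∷ arcs ((y , us) ∷ (b , vs) ∷ K)
          arcsK = ↭-trans (arcs-↭ permJ) (↭-trans (↭-reflexive (trans
              (cong (_++ arcs K) (steps-++ y us b vs))
              (++-assoc (steps y us) ((end y us , b) ∷ steps b vs) (arcs K))))
            (shift _ (steps y us) _))
          split : ∃ λ E → arcs Fv ↭ (a , b) ∷ E
          split = ∈-∃↭ ab∈
          arcsFv↭ : (v , s) ∷ proj₁ split ↭ arcs ((y , us) ∷ (b , vs) ∷ K)
          arcsFv↭ = drop-∷ (↭-trans (swap _ _ refl)
            (↭-trans (↭-prep _ (↭-sym (proj₂ split))) (↭-trans (↭-sym arcsJ) arcsK)))
          classify : ∀ {e} → e ∈ (v , s) ∷ proj₁ split → e ∈ arcs F ⊎ e ∈ (v , s) ∷ added fr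
          classify (here e) = inj₂ (here e)
          classify (there p) with arcs⊆ fr (∈-resp-↭ (↭-sym (proj₂ split)) (there p))
          ... | inj₁ q = inj₁ q
          ... | inj₂ q = inj₂ (there q)
          inJ : ∀ {s′} → s′ ∈ map proj₁ J → s′ ∈ y ∷ b ∷ map proj₁ K
          inJ p with ∈-resp-↭ (PermP.map⁺ proj₁ permJ) p
          ... | here e = here e
          ... | there q = there (there q)
          headsOK : ∀ {s′} → s′ ∈ map proj₁ Fv → s′ ≢ s → s′ ∈ y ∷ b ∷ map proj₁ K
          headsOK (here e) _ = inJ (here e)
          headsOK (there p) s′≢s with ∈-resp-↭ (PermP.map⁺ proj₁ perm) p
          ... | here e = ⊥-elim (s′≢s e)
          ... | there q = inJ (there q)

      arc-unique : ∀ {a b b′} → (a , b) ∈ arcs F → (a , b′) ∈ arcs F → b ≡ b′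
      arc-unique p q = cong proj₂ (map-injectiveOn proj₁
        (proj₁ (proj₂ (Unique-++⁻ (map (uncurry end) F) (Unique-↭ (tails-ends F) (proj₁ rf))))) p q refl)

      -- One head `s` serves all of `ws`, since the rearrangements are alternatives and never
      -- carried out together. Distinct `v` have distinct colours to `s`, and an arc of `F` is
      -- determined by its tail, so the freed tails are distinct.
      free-all : ∀ {ℓ} s → s ∈ map proj₁ F → (ws : List (Σ V (Free ℓ))) → Unique (map proj₁ ws) →
        All (λ w → s ∉ bad w) ws →
        Shorter F ⊎ ∃ λ (as : List (Σ V (Free (suc ℓ)))) → length as ≡ length ws × Unique (map proj₁ as) ×
          (∀ {a} → a ∈ map proj₁ as → ∃₂ λ v b → v ∈ map proj₁ ws × v ≢ s × (a , b) ∈ arcs F × c a b ≡ c v s)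
      free-all s s∈ [] u _ = inj₂ ([] , refl , [] , λ ())
      free-all s s∈ (w@(v , _) ∷ ws) (v∉ ∷ u) (ok ∷ oks) with free-next w s∈ ok | free-all s s∈ ws u oks
      ... | inj₁ sh | _ = inj₁ sh
      ... | inj₂ _ | inj₁ sh = inj₁ sh
      ... | inj₂ (a , v≢s , (b , ab∈ , ce) , fr) | inj₂ (as , len , uas , origin) =
        inj₂ ((a , fr) ∷ as , cong suc len , All.tabulate fresh ∷ uas , origin′)
        where
        fresh : ∀ {a′} → a′ ∈ map proj₁ as → a ≢ a′
        fresh a∈ refl with origin a∈
        ... | v′ , b′ , v′∈ , v′≢s , ab′∈ , ce′ with arc-unique ab∈ ab′∈
        ... | refl = All.lookup v∉ v′∈ (c-inj (v≢s ∘ sym) (v′≢s ∘ sym)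
                (trans (c-sym s v) (trans (sym ce) (trans ce′ (c-sym v′ s)))))
        origin′ : ∀ {a′} → a′ ∈ a ∷ map proj₁ as →
          ∃₂ λ v′ b′ → v′ ∈ v ∷ map proj₁ ws × v′ ≢ s × (a′ , b′) ∈ arcs F × c a′ b′ ≡ c v′ s
        origin′ (here refl) = v , b , here refl , v≢s , ab∈ , ce
        origin′ (there p) with origin p
        ... | v′ , b′ , v′∈ , r = v′ , b′ , there v′∈ , r

      ends : ∀ ℓ → List (Σ V (Free ℓ))
      ends ℓ = mapWith∈ F (λ {ch} p → uncurry end ch , weaken z≤n (end-free p))

      ends-proj : ∀ ℓ → map proj₁ (ends ℓ) ≡ map (uncurry end) F
      ends-proj ℓ = trans (map-mapWith∈ F _ proj₁) (mapWith∈≗map (uncurry end) F)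

      module _ (K : ℕ) (dense : length (vertices F) ≤ K * length F) (0<F : 0 < length F) where

        -- The new list consists of the ends of `F`, free at no cost, and of the tails freed from
        -- `ws` through a head that is bad for few of them. Ends and tails are disjoint, so a round
        -- gains `length F` up to the number of bad members of `ws`.
        grow : ∀ ℓ (ws : List (Σ V (Free ℓ))) → Unique (map proj₁ ws) →
          Shorter F ⊎ ∃ λ (ws′ : List (Σ V (Free (suc ℓ)))) → Unique (map proj₁ ws′) ×
            length ws + length F ≤ length ws′ + K * suc (ℓ + ℓ)
        grow ℓ ws u with light-column _∈ᵛ?_ bad (suc (ℓ + ℓ)) ws (map proj₁ F)
                           (subst (0 <_) (sym (length-map proj₁ F)) 0<F) heads-unique (λ {w} _ → bad-length w)
        ... | s , s∈ , light with free-all s s∈ good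
                (Unique-⊆ (SubP.map⁺ proj₁ (filter-⊆ good? ws)) u)
                (AllP.all-filter good? ws)
          where
          good? = λ w → ¬? (s ∈ᵛ? bad w)
          good = filter good? ws
        ... | inj₁ sh = inj₁ sh
        ... | inj₂ (as , len , uas , origin) = inj₂ (ends (suc ℓ) ++ as , unique , bound)
          where
          open ≤-Reasoning
          unique : Unique (map proj₁ (ends (suc ℓ) ++ as))
          unique = subst Unique (sym (trans (map-++ proj₁ (ends (suc ℓ)) as) (cong (_++ map proj₁ as) (ends-proj (suc ℓ)))))
            (UniqueP.++⁺ (proj₁ parts) uas disjoint)
            where
            parts = Unique-++⁻ (map (uncurry end) F) (Unique-↭ (tails-ends F) (proj₁ rf))
            disjoint : ∀ {a} → a ∈ map (uncurry end) F × a ∈ map proj₁ as → ⊥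
            disjoint (p , q) with origin q
            ... | _ , _ , _ , _ , ab∈ , _ = proj₂ (proj₂ parts) p (∈-map⁺ proj₁ ab∈)
          t = length F
          bads = count (λ w → s ∈ᵛ? bad w) ws
          -- At most `K * t` vertices are in `ws`, each with at most 2ℓ + 1 bad heads; averaging
          -- over the `t` heads cancels `t`.
          few : bads ≤ K * suc (ℓ + ℓ)
          few = *-cancelʳ-≤ bads (K * suc (ℓ + ℓ)) t {{>-nonZero 0<F}} (begin
            bads * t ≡⟨ cong (bads *_) (length-map proj₁ F) ⟨
            bads * length (map proj₁ F) ≤⟨ light ⟩
            length ws * suc (ℓ + ℓ) ≡⟨ cong (_* suc (ℓ + ℓ)) (length-map proj₁ ws) ⟨
            length (map proj₁ ws) * suc (ℓ + ℓ) ≤⟨ *-monoˡ-≤ (suc (ℓ + ℓ)) (unique-length u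
              (λ p → let (w , _ , e) = ∈-map⁻ proj₁ p in subst (_∈ vertices F) (sym e) (free-vertex (proj₂ w)))) ⟩
            length (vertices F) * suc (ℓ + ℓ) ≤⟨ *-monoˡ-≤ (suc (ℓ + ℓ)) dense ⟩
            K * t * suc (ℓ + ℓ) ≡⟨ *-assoc K t _ ⟩
            K * (t * suc (ℓ + ℓ)) ≡⟨ cong (K *_) (*-comm t _) ⟩
            K * (suc (ℓ + ℓ) * t) ≡⟨ *-assoc K (suc (ℓ + ℓ)) t ⟨
            K * suc (ℓ + ℓ) * t ∎)
          bound : length ws + t ≤ length (ends (suc ℓ) ++ as) + K * suc (ℓ + ℓ)
          bound = begin
            length ws + t ≡⟨ cong (_+ t) (count-¬ (λ w → s ∈ᵛ? bad w) ws) ⟨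
            bads + count (λ w → ¬? (s ∈ᵛ? bad w)) ws + t ≡⟨ cong (λ k → bads + k + t) len ⟨
            bads + length as + t ≤⟨ +-monoˡ-≤ t (+-monoˡ-≤ (length as) few) ⟩
            K * suc (ℓ + ℓ) + length as + t ≡⟨ rearrange (K * suc (ℓ + ℓ)) (length as) t ⟩
            t + length as + K * suc (ℓ + ℓ) ≡⟨ cong (λ k → k + length as + K * suc (ℓ + ℓ)) ends-length ⟨
            length (ends (suc ℓ)) + length as + K * suc (ℓ + ℓ) ≡⟨ cong (_+ K * suc (ℓ + ℓ)) (length-++ (ends (suc ℓ))) ⟨
            length (ends (suc ℓ) ++ as) + K * suc (ℓ + ℓ) ∎
            where
            rearrange : ∀ a b t → a + b + t ≡ t + b + a
            rearrange = solve-∀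
            ends-length : length (ends (suc ℓ)) ≡ t
            ends-length = trans (sym (length-map proj₁ (ends (suc ℓ))))
              (trans (cong length (ends-proj (suc ℓ))) (length-map (uncurry end) F))

        rounds : ∀ L ℓ → ℓ ≤ L → Shorter F ⊎ ∃ λ (ws : List (Σ V (Free ℓ))) → Unique (map proj₁ ws) ×
          ℓ * length F ≤ length ws + ℓ * (K * suc (L + L))
        rounds L zero _ = inj₂ ([] , [] , z≤n)
        rounds L (suc ℓ) ℓ<L with rounds L ℓ (<⇒≤ ℓ<L)
        ... | inj₁ sh = inj₁ sh
        ... | inj₂ (ws , u , le) with grow ℓ ws u
        ... | inj₁ sh = inj₁ sh
        ... | inj₂ (ws′ , u′ , le′) = inj₂ (ws′ , u′ , linear 0
          (+-mono-≤ le (+-mono-≤ le′ (*-monoʳ-≤ K (s≤s (+-mono-≤ (<⇒≤ ℓ<L) (<⇒≤ ℓ<L))))))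
          (eq ℓ (length F) (length ws) (length ws′) (K * suc (L + L)) (K * suc (ℓ + ℓ))))
          where
          eq : ∀ ℓ t w w′ k k′ → suc ℓ * t + (w + ℓ * k + (w′ + k′ + k)) + 0 ≡ w′ + suc ℓ * k + (ℓ * t + (w + t + k′))
          eq = solve-∀

        shorten : K * (2 * suc (4 * K)) < length F → 0 < K → Shorter F
        -- With `t` components, 2K rounds would free 2Kt vertices up to a loss of 2K²(4K + 1). By
        -- `big` this loss is below Kt, so more than Kt vertices would be free, contradicting
        -- `dense`.
        shorten big 0<K with rounds (2 * K) (2 * K) ≤-refl
        ... | inj₁ sh = sh
        ... | inj₂ (ws , u , le) = ⊥-elim (<⇒≱ big (*-cancelˡ-≤ K {{>-nonZero 0<K}} (linear 0
            (+-mono-≤ le (≤-trans ws≤ dense)) (eq K (length F) (length ws)))))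
          where
          ws≤ : length ws ≤ length (vertices F)
          ws≤ = subst (_≤ length (vertices F)) (length-map proj₁ ws) (unique-length u
              (λ p → let (w , _ , e) = ∈-map⁻ proj₁ p in subst (_∈ vertices F) (sym e) (free-vertex (proj₂ w))))
          eq : ∀ K t w → K * t + (w + 2 * K * (K * suc (2 * K + 2 * K)) + K * t) + 0
            ≡ K * (K * (2 * suc (4 * K))) + (2 * K * t + w)
          eq = solve-∀

    -- While `K` times the number of components exceeds the number of vertices, the assumed size of
    -- the latter forces enough components for `shorten` to apply.
    few-components : ∀ K → 0 < K → ∀ F → RainbowForest F →
      K * suc (K * (2 * suc (4 * K))) ≤ length (vertices F) →
      ∃ λ G → RainbowForest G × vertices G ↭ vertices F × K * length G ≤ length (vertices F)
    few-components K 0<K F = go (length F) F ≤-refl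
      where
      go : ∀ k F → length F ≤ k → RainbowForest F →
        K * suc (K * (2 * suc (4 * K))) ≤ length (vertices F) →
        ∃ λ G → RainbowForest G × vertices G ↭ vertices F × K * length G ≤ length (vertices F)
      go k F len rf big with K * length F ≤? length (vertices F)
      ... | yes le = F , rf , refl , le
      go zero [] len rf big | no ≰ = ⊥-elim (≰ (subst (_≤ 0) (sym (*-zeroʳ K)) z≤n))
      go (suc k) F len rf big | no ≰
        with shorten F rf K (<⇒≤ (≰⇒> ≰)) (≤-trans (s≤s z≤n) large) large 0<K
        where
        large : K * (2 * suc (4 * K)) < length F
        large = *-cancelˡ-≤ K {{>-nonZero 0<K}} (≤-trans big (<⇒≤ (≰⇒> ≰)))
      ... | G , rg , vG , size with go k G (≤-pred (≤-trans (≤-reflexive size) len)) rg (subst (_ ≤_) (sym (↭-length vG)) big)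
      ... | H , rh , vH , le = H , rh , ↭-trans vH vG , ≤-trans le (≤-reflexive (↭-length vG))

    singletons : RainbowForest (map (_, []) (allFin n)) × vertices (map (_, []) (allFin n)) ≡ allFin n
    singletons = (subst Unique (sym (verts (allFin n))) (UniqueP.allFin⁺ n)
        , subst (Unique ∘ map colour) (sym (noArcs (allFin n))) []) , verts (allFin n)
      where
      verts : ∀ (vs : List V) → vertices (map (_, []) vs) ≡ vs
      verts [] = refl
      verts (v ∷ vs) = cong (v ∷_) (verts vs)
      noArcs : ∀ (vs : List V) → arcs (map (_, []) vs) ≡ []
      noArcs [] = refl
      noArcs (v ∷ vs) = noArcs vs

  -- Path systems: cutting, reversing and joining.

  concat-↭ : ∀ {A : Set} {xss yss : List (List A)} → xss ↭ yss → concat xss ↭ concat yss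
  concat-↭ {xss = xss} {yss} p = ↭-trans (↭-reflexive (cong concat (sym (map-id xss))))
    (↭-trans (concatMap-↭ id p) (↭-reflexive (cong concat (map-id yss))))

  split-unique : ∀ {A : Set} {a : A} xs {ys} xs′ {ys′} → Unique (xs ++ a ∷ ys) →
    xs ++ a ∷ ys ≡ xs′ ++ a ∷ ys′ → xs ≡ xs′ × ys ≡ ys′
  split-unique [] [] u refl = refl , refl
  split-unique [] (x ∷ xs′) (a∉ ∷ u) refl = ⊥-elim (All.lookup a∉ (∈-++⁺ʳ xs′ (here refl)) refl)
  split-unique (x ∷ xs) [] (a∉ ∷ u) refl = ⊥-elim (All.lookup a∉ (∈-++⁺ʳ xs (here refl)) refl)
  split-unique (x ∷ xs) (x′ ∷ xs′) (_ ∷ u) e with split-unique xs xs′ u (∷-injectiveʳ e)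
  ... | p , q = cong₂ _∷_ (∷-injectiveˡ e) p , q

  count-⊎ : ∀ {A : Set} {P Q R : A → Set} (P? : Decidable P) (Q? : Decidable Q) (R? : Decidable R) →
    (∀ {x} → P x → Q x ⊎ R x) → ∀ xs → count P? xs ≤ count Q? xs + count R? xs
  count-⊎ P? Q? R? f xs = ≤-trans (count-⇒ P? (λ x → Q? x ⊎-dec R? x) f xs)
    (≤-trans (m≤m+n _ _) (≤-reflexive (count-∪∩ Q? R? xs)))

  map-∃ : ∀ {A B : Set} (f : A → B) {xs ys} → All (_∈ map f xs) ys → ∃ λ zs → map f zs ≡ ys
  map-∃ f [] = [] , refl
  map-∃ f (p ∷ ps) with ∈-map⁻ f p | map-∃ f ps
  ... | x , _ , refl | zs , refl = x ∷ zs , refl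

  Ends : ∀ {A : Set} → A → A → List A → Set
  Ends h l xs = ∃ λ ys → xs ≡ h ∷ ys × end h ys ≡ l

  module _ {A : Set} where

    Ends-++ : ∀ {h l h′ l′ : A} {xs ys} → Ends h l xs → Ends h′ l′ ys → Ends h l′ (xs ++ ys)
    Ends-++ {h} (xs , refl , _) (ys , refl , e) = xs ++ _ ∷ ys , refl , trans (end-++ h xs _ ys) e

    Ends-∷ : ∀ (h : A) xs → Ends h (end h xs) (h ∷ xs)
    Ends-∷ h xs = xs , refl , refl

    Ends-mid : ∀ {h x : A} ys → Ends h x ((h ∷ ys) ++ x ∷ [])
    Ends-mid {h} {x} ys = _ , refl , end-++ h ys x []

    Ends-reverse : ∀ {h l : A} {xs} → Ends h l xs → Ends l h (reverse xs)
    Ends-reverse {h} (ys , refl , refl) = go h ys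
      where
      go : ∀ h ys → Ends (end h ys) h (reverse (h ∷ ys))
      go h [] = [] , refl , refl
      go h (y ∷ ys) = subst (Ends _ _) (sym (unfold-reverse h (y ∷ ys))) (Ends-++ (go y ys) ([] , refl , refl))

    Ends-prefix : ∀ {h l x : A} xs {ys} → Ends h l (xs ++ x ∷ ys) → Ends h x (xs ++ x ∷ [])
    Ends-prefix [] (_ , refl , _) = [] , refl , refl
    Ends-prefix (x′ ∷ xs) (_ , refl , _) = _ , refl , end-++ x′ xs _ []

  module PathSystem {n : ℕ} (c : Fin n → Fin n → ℕ)
    (c-sym : ∀ u v → c u v ≡ c v u) where

    private
      V = Fin n

    ec : List V → List ℕ
    ec = edgeColors c

    colours : List (List V) → List ℕ
    colours = concatMap ec

    -- Unlike chains, paths are now plain lists that may be empty, so that a path can be cut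
    -- anywhere without asking whether a side vanishes. Empty lists only inflate the count of paths.
    PathSystem : List (List V) → Set
    PathSystem F = Unique (concat F) × Unique (colours F)

    ec-steps : ∀ x xs → ec (x ∷ xs) ≡ map (uncurry c) (steps x xs)
    ec-steps x [] = refl
    ec-steps x (y ∷ ys) = cong (c x y ∷_) (ec-steps y ys)

    ec-join : ∀ {h u w l} {U W} → Ends h u U → Ends w l W → ec (U ++ W) ≡ ec U ++ c u w ∷ ec W
    ec-join {h} {w = w} (us , refl , refl) (ws , refl , _) = trans (ec-steps h (us ++ w ∷ ws))
      (trans (cong (map (uncurry c)) (steps-++ h us w ws))
        (trans (map-++ (uncurry c) (steps h us) _)
          (cong₂ (λ p q → p ++ c (end h us) w ∷ q) (sym (ec-steps h us)) (sym (ec-steps w ws)))))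

    ec-mid : ∀ xs x ys → ec (xs ++ x ∷ ys) ≡ ec (xs ++ x ∷ []) ++ ec (x ∷ ys)
    ec-mid [] x ys = refl
    ec-mid (z ∷ []) x ys = refl
    ec-mid (z ∷ z′ ∷ xs) x ys = cong (c z z′ ∷_) (ec-mid (z′ ∷ xs) x ys)

    ec-++ : ∀ xs ys → ∃ λ E → ec (xs ++ ys) ↭ E ++ ec xs ++ ec ys
    ec-++ [] ys = [] , refl
    ec-++ (x ∷ xs) [] = [] , ↭-reflexive (trans (cong (ec ∘ (x ∷_)) (++-identityʳ xs)) (sym (++-identityʳ _)))
    ec-++ (x ∷ xs) (y ∷ ys) = c (end x xs) y ∷ [] ,
      ↭-trans (↭-reflexive (ec-join (Ends-∷ x xs) (Ends-∷ y ys))) (shift _ (ec (x ∷ xs)) _)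

    ec-++ˡ : ∀ xs ys {γ} → γ ∈ ec xs → γ ∈ ec (xs ++ ys)
    ec-++ˡ xs ys p with ec-++ xs ys
    ... | E , perm = ∈-resp-↭ (↭-sym perm) (∈-++⁺ʳ E (∈-++⁺ˡ p))

    ec-++ʳ : ∀ xs ys {γ} → γ ∈ ec ys → γ ∈ ec (xs ++ ys)
    ec-++ʳ xs ys p with ec-++ xs ys
    ... | E , perm = ∈-resp-↭ (↭-sym perm) (∈-++⁺ʳ E (∈-++⁺ʳ (ec xs) p))

    ec-reverse : ∀ xs → ec (reverse xs) ↭ ec xs
    ec-reverse [] = refl
    ec-reverse (x ∷ []) = refl
    ec-reverse (x ∷ y ∷ ys) = ↭-trans
      (↭-reflexive (trans (cong ec (unfold-reverse x (y ∷ ys)))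
        (ec-join (Ends-reverse (Ends-∷ y ys)) (Ends-∷ x []))))
      (↭-trans (shift (c y x) (ec (reverse (y ∷ ys))) [])
        (↭-trans (↭-reflexive (cong₂ _∷_ (c-sym y x) (++-identityʳ _))) (↭-prep _ (ec-reverse (y ∷ ys)))))

    ec-length : ∀ xs → length (ec xs) ≤ length xs
    ec-length [] = z≤n
    ec-length (x ∷ []) = z≤n
    ec-length (x ∷ y ∷ ys) = s≤s (ec-length (y ∷ ys))

    ec∈⇒split : ∀ xs {γ} → γ ∈ ec xs → ∃₂ λ us a → ∃₂ λ b vs → xs ≡ us ++ a ∷ b ∷ vs × c a b ≡ γ
    ec∈⇒split (x ∷ y ∷ ys) (here refl) = [] , x , y , ys , refl , refl
    ec∈⇒split (x ∷ y ∷ ys) (there p) with ec∈⇒split (y ∷ ys) p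
    ... | us , a , b , vs , e , ce = x ∷ us , a , b , vs , cong (x ∷_) e , ce

    infix 4 _⊒_
    -- `G` results from `F` by deleting edges, reversing paths and reordering: vertices are kept and
    -- colours can only be lost, so rainbow path systems are preserved.
    record _⊒_ (F G : List (List V)) : Set where
      constructor refines
      field
        verts : concat F ↭ concat G
        {removed} : List ℕ
        cols : colours F ↭ removed ++ colours G

    open _⊒_

    colours-++ : ∀ F G → colours (F ++ G) ≡ colours F ++ colours G
    colours-++ = concatMap-++ ec

    ⊒-↭ : ∀ {F G} → F ↭ G → F ⊒ G
    ⊒-↭ p = refines (concat-↭ p) {[]} (concatMap-↭ ec p)

    ⊒-refl : ∀ {F} → F ⊒ F
    ⊒-refl = ⊒-↭ refl

    ⊒-trans : ∀ {F G H} → F ⊒ G → G ⊒ H → F ⊒ H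
    ⊒-trans (refines v {r} p) (refines v′ {r′} p′) = refines (↭-trans v v′) {r ++ r′}
      (↭-trans p (↭-trans (PermP.++⁺ˡ r p′) (↭-reflexive (sym (++-assoc r r′ _)))))

    ⊒-∷ : ∀ X {F G} → F ⊒ G → X ∷ F ⊒ X ∷ G
    ⊒-∷ X (refines v {r} p) = refines (PermP.++⁺ˡ X v) {r} (↭-trans (PermP.++⁺ˡ (ec X) p) (shifts (ec X) r))

    ⊒-++ : ∀ H {F G} → F ⊒ G → H ++ F ⊒ H ++ G
    ⊒-++ [] r = r
    ⊒-++ (X ∷ H) r = ⊒-∷ X (⊒-++ H r)

    ⊒-cut : ∀ X Y {F} → (X ++ Y) ∷ F ⊒ X ∷ Y ∷ F
    ⊒-cut X Y {F} with ec-++ X Y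
    ... | E , p = refines (↭-reflexive (++-assoc X Y (concat F))) {E}
      (↭-trans (PermP.++⁺ʳ (colours F) p) (↭-reflexive (trans (++-assoc E _ (colours F))
        (cong (E ++_) (++-assoc (ec X) (ec Y) (colours F))))))

    ⊒-reverse : ∀ X {F} → X ∷ F ⊒ reverse X ∷ F
    ⊒-reverse X {F} = refines (PermP.++⁺ʳ (concat F) (↭-sym (PermP.↭-reverse X))) {[]}
      (PermP.++⁺ʳ (colours F) (↭-sym (ec-reverse X)))

    ⊒-system : ∀ {F G} → F ⊒ G → PathSystem F → PathSystem G
    ⊒-system (refines v {r} p) (uv , uc) = Unique-↭ v uv , proj₁ (proj₂ (Unique-++⁻ r (Unique-↭ p uc)))

    -- In a rainbow system a colour sits on at most one edge, so a single cut removes it.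
    cut-colour : ∀ γ F → Unique (colours F) → ∃ λ G → F ⊒ G × length G ≤ suc (length F) × γ ∉ colours G
    cut-colour γ F u with mem? _≟_ γ (colours F)
    ... | no γ∉ = F , ⊒-refl , n≤1+n _ , γ∉
    ... | yes γ∈ with find (∈-concatMap⁻ ec {xs = F} γ∈)
    ... | p , p∈ , γ∈p with ∈-∃↭ p∈ | ec∈⇒split p γ∈p
    ... | F₀ , perm | us , a , b , vs , refl , refl = (us ++ a ∷ []) ∷ (b ∷ vs) ∷ F₀ ,
      ⊒-trans (⊒-↭ perm) (subst (λ q → q ∷ F₀ ⊒ (us ++ a ∷ []) ∷ (b ∷ vs) ∷ F₀) (++-assoc us (a ∷ []) (b ∷ vs)) (⊒-cut (us ++ a ∷ []) (b ∷ vs))) ,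
      s≤s (≤-reflexive (sym (↭-length perm))) , absent
      where
      cols↭ : colours F ↭ c a b ∷ colours ((us ++ a ∷ []) ∷ (b ∷ vs) ∷ F₀)
      cols↭ = ↭-trans (concatMap-↭ ec perm) (↭-trans (↭-reflexive (trans
          (cong (_++ colours F₀) (ec-mid us a (b ∷ vs)))
          (++-assoc (ec (us ++ a ∷ [])) (c a b ∷ ec (b ∷ vs)) (colours F₀))))
        (shift _ (ec (us ++ a ∷ [])) _))
      absent : c a b ∉ colours ((us ++ a ∷ []) ∷ (b ∷ vs) ∷ F₀)
      absent q with Unique-↭ cols↭ u
      ... | ab∉ ∷ _ = All.lookup ab∉ q refl

    isolate : ∀ z F → z ∈ concat F → ∃ λ G → F ⊒ (z ∷ []) ∷ G × length G ≤ suc (length F)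
    isolate z F z∈ with ∈-concat⁻′ F z∈
    ... | p , z∈p , p∈ with ∈-∃↭ p∈ | ∈-∃++ z∈p
    ... | F₀ , perm | us , vs , refl = us ∷ vs ∷ F₀ ,
      ⊒-trans (⊒-↭ perm) (⊒-trans (⊒-cut us (z ∷ vs)) (⊒-trans (⊒-∷ us (⊒-cut (z ∷ []) vs)) (⊒-↭ (swap _ _ refl)))) ,
      s≤s (≤-reflexive (sym (↭-length perm)))

    -- The paths in `G` are expendable: if the colour of the connecting edge occurs there, it is cut
    -- away at the price of one more path. Only the protected paths `U`, `W`, `H` have to avoid it,
    -- and they stay intact.
    join : ∀ {h u w l U W} H G → PathSystem (U ∷ W ∷ H ++ G) → Ends h u U → Ends w l W →
      c u w ∉ colours (U ∷ W ∷ H) →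
      ∃ λ G′ → PathSystem ((U ++ W) ∷ H ++ G′) × length G′ ≤ suc (length G) ×
        concat ((U ++ W) ∷ H ++ G′) ↭ concat (U ∷ W ∷ H ++ G)
    join {u = u} {w} {U = U} {W} H G sys eU eW new
      with cut-colour (c u w) G (proj₁ (proj₂ (Unique-++⁻ (colours (U ∷ W ∷ H))
             (subst Unique (colours-++ (U ∷ W ∷ H) G) (proj₂ sys)))))
    ... | G′ , ref , len , absent = G′ , (uv , uc) , len , vs↭
      where
      ref′ : U ∷ W ∷ H ++ G ⊒ U ∷ W ∷ H ++ G′
      ref′ = ⊒-++ (U ∷ W ∷ H) ref
      vs↭ : concat ((U ++ W) ∷ H ++ G′) ↭ concat (U ∷ W ∷ H ++ G)
      vs↭ = ↭-trans (↭-reflexive (++-assoc U W _)) (↭-sym (verts ref′))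
      uv : Unique (concat ((U ++ W) ∷ H ++ G′))
      uv = Unique-↭ (↭-sym vs↭) (proj₁ sys)
      uc : Unique (colours ((U ++ W) ∷ H ++ G′))
      uc = Unique-↭ (↭-sym (↭-trans (↭-reflexive (trans (cong (_++ colours (H ++ G′)) (ec-join eU eW))
             (++-assoc (ec U) _ _))) (shift _ (ec U) _)))
           (All.tabulate fresh ∷ proj₂ (⊒-system ref′ sys))
        where
        fresh : ∀ {γ} → γ ∈ colours (U ∷ W ∷ H ++ G′) → c u w ≢ γ
        fresh p refl with ∈-++⁻ (colours (U ∷ W ∷ H)) (subst (_ ∈_) (colours-++ (U ∷ W ∷ H) G′) p)
        ... | inj₁ q = new q
        ... | inj₂ q = absent q

    join-colours : ∀ {h u w l U W} H → Ends h u U → Ends w l W → ∀ {γ} → γ ∈ colours ((U ++ W) ∷ H) →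
      γ ≡ c u w ⊎ γ ∈ colours (U ∷ W ∷ H)
    join-colours {U = U} {W} H eU eW p with ∈-++⁻ (ec (U ++ W)) p
    ... | inj₂ q = inj₂ (∈-++⁺ʳ (ec U) (∈-++⁺ʳ (ec W) q))
    ... | inj₁ q with ∈-++⁻ (ec U) (subst (_ ∈_) (ec-join eU eW) q)
    ... | inj₁ r = inj₂ (∈-++⁺ˡ r)
    ... | inj₂ (here e) = inj₁ e
    ... | inj₂ (there r) = inj₂ (∈-++⁺ʳ (ec U) (∈-++⁺ˡ r))

    -- Three joins in a row. Once used, a connecting edge belongs to the protected part, whence the
    -- pairwise inequalities between the three colours.
    assemble : ∀ {q₁ q a₀ a c₀ c₁ e₀ e₁ Q A C E} G → PathSystem (Q ∷ A ∷ C ∷ E ∷ G) →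
      Ends q₁ q Q → Ends a₀ a A → Ends c₀ c₁ C → Ends e₀ e₁ E →
      let old = colours (Q ∷ A ∷ C ∷ E ∷ []) in
      c q a₀ ∉ old → c a c₀ ∉ old → c c₁ e₀ ∉ old →
      c a c₀ ≢ c q a₀ → c c₁ e₀ ≢ c q a₀ → c c₁ e₀ ≢ c a c₀ →
      ∃ λ G′ → PathSystem ((((Q ++ A) ++ C) ++ E) ∷ G′) × length G′ ≤ 3 + length G ×
        concat ((((Q ++ A) ++ C) ++ E) ∷ G′) ↭ concat (Q ∷ A ∷ C ∷ E ∷ G)
    assemble {Q = Q} {A} {C} {E} G sys eQ eA eC eE α∉ β∉ γ∉ β≢α γ≢α γ≢β
      with join (C ∷ E ∷ []) G sys eQ eA α∉
    ... | G₁ , sys₁ , len₁ , vs₁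
      with join (E ∷ []) G₁ sys₁ (Ends-++ eQ eA) eC
             ([ β≢α , β∉ ]′ ∘ join-colours (C ∷ E ∷ []) eQ eA)
    ... | G₂ , sys₂ , len₂ , vs₂
      with join [] G₂ sys₂ (Ends-++ (Ends-++ eQ eA) eC) eE
             ([ γ≢β , [ γ≢α , γ∉ ]′ ∘ join-colours (C ∷ E ∷ []) eQ eA ]′
               ∘ join-colours (E ∷ []) (Ends-++ eQ eA) eC)
    ... | G₃ , sys₃ , len₃ , vs₃ = G₃ , sys₃ ,
      ≤-trans len₃ (s≤s (≤-trans len₂ (s≤s len₁))) , ↭-trans vs₃ (↭-trans vs₂ vs₁)

  -- Splicing into the distinguished path.

  module _ {A : Set} where

    interior : ℕ → List A → List A
    interior g Q = drop g (take (length Q ∸ g) Q)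

    interior-⊆ : ∀ g Q → interior g Q ⊆ Q
    interior-⊆ g Q = ⊆-trans (SubP.drop-⊆ g _) (take-⊆ (length Q ∸ g) Q)

    interior-length : ∀ g Q → length Q ≤ length (interior g Q) + (g + g)
    interior-length g Q = ≤-trans (m≤n+m∸n (length Q) (g + g)) (≤-reflexive (trans (+-comm (g + g) _) (cong (_+ (g + g)) (sym len))))
      where
      len : length (interior g Q) ≡ length Q ∸ (g + g)
      len = trans (length-drop g (take (length Q ∸ g) Q))
        (trans (cong (_∸ g) (trans (length-take (length Q ∸ g) Q) (m≤n⇒m⊓n≡m (m∸n≤m (length Q) g))))
          (∸-+-assoc (length Q) g g))

    interior-split : ∀ g Q {x} → x ∈ interior g Q → ∃₂ λ Q₁ Q₂ → Q ≡ Q₁ ++ x ∷ Q₂ × g ≤ length Q₁ × g ≤ length Q₂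
    interior-split g Q {x} x∈ with ∈-∃++ x∈
    ... | as , bs , eq = take g T ++ as , bs ++ D , split , left , right
      where
      T = take (length Q ∸ g) Q
      D = drop (length Q ∸ g) Q
      assoc : ∀ (p q r s : List A) → (p ++ q ++ r) ++ s ≡ (p ++ q) ++ r ++ s
      assoc p q r s = trans (++-assoc p (q ++ r) s) (trans (cong (p ++_) (++-assoc q r s)) (sym (++-assoc p q (r ++ s))))
      split : Q ≡ (take g T ++ as) ++ x ∷ bs ++ D
      split = trans (sym (take++drop≡id (length Q ∸ g) Q))
        (trans (cong (_++ D) (trans (sym (take++drop≡id g T)) (cong (take g T ++_) eq)))
          (assoc (take g T) as (x ∷ bs) D))
      g<T : g < length T
      g<T = m∸n≢0⇒n<m λ e → 0≢1+n (trans (sym e) (trans (sym (length-drop g T)) (trans (cong length eq) (length-++-sucʳ as x bs))))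
      left : g ≤ length (take g T ++ as)
      left = ≤-trans (≤-reflexive (sym (trans (length-take g T) (m≤n⇒m⊓n≡m (<⇒≤ g<T)))))
        (length-++-≤ˡ (take g T))
      right : g ≤ length (bs ++ D)
      right = ≤-trans (≤-reflexive (sym (trans (length-drop (length Q ∸ g) Q) (m∸[m∸n]≡n
        (≤-trans (<⇒≤ g<T) (≤-trans (≤-reflexive (length-take (length Q ∸ g) Q)) (m⊓n≤n (length Q ∸ g) _))))))) (length-++-≤ʳ D {bs})

    concatMap-interior-⊆ : ∀ g F → concatMap (interior g) F ⊆ concat F
    concatMap-interior-⊆ g [] = []
    concatMap-interior-⊆ g (Q ∷ F) = SubP.++⁺ (interior-⊆ g Q) (concatMap-interior-⊆ g F)

    concatMap-interior-length : ∀ g F → length (concat F) ≤ length (concatMap (interior g) F) + length F * (g + g)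
    concatMap-interior-length g [] = z≤n
    concatMap-interior-length g (Q ∷ F) = ≤-trans (≤-reflexive (length-++ Q))
      (≤-trans (+-mono-≤ (interior-length g Q) (concatMap-interior-length g F))
        (≤-reflexive (trans (eq (length (interior g Q)) (length (concatMap (interior g) F)) (g + g) (length F * (g + g)))
          (cong (_+ (g + g + length F * (g + g))) (sym (length-++ (interior g Q)))))))
      where
      eq : ∀ i j d e → i + d + (j + e) ≡ i + j + (d + e)
      eq = solve-∀

    -- Here `p` will be joined to one anchor and `q` or `r` to the other. Two candidates are kept
    -- because one of them may give both connecting edges the same colour; properness rules this out
    -- for the other.
    CloseTriple : (A → Set) → ℕ → List A → Set
    CloseTriple P d xs = ∃₂ λ X p → ∃₂ λ q r → P p × P q × P r × q ≢ r ×
      (∃₂ λ D T → xs ≡ X ++ p ∷ D ++ q ∷ T × length D ≤ d) ×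
      (∃₂ λ D T → xs ≡ X ++ p ∷ D ++ r ∷ T × length D ≤ d)

    close-triple : {P : A → Set} (P? : Decidable P) → ∀ d xs → Unique xs →
      2 * (length xs + d) < count P? xs * d → CloseTriple P d xs
    close-triple P? d xs u h with cluster P? 2 d xs h
    ... | ls , ms , rs , p ∷ q ∷ r ∷ [] , refl , short , sub , _ , pp ∷ pq ∷ pr ∷ [] with ⊆-∃++ sub
    ... | D₀ , R₁ , refl , sub₁ with ⊆-∃++ sub₁
    ... | D₁ , R₂ , refl , sub₂ with ⊆-∃++ sub₂
    ... | D₂ , R₃ , refl , _ = ls ++ D₀ , p , q , r , pp , pq , pr , q≢r ,
      (D₁ , (D₂ ++ r ∷ R₃) ++ rs , split D₁ (q ∷ D₂ ++ r ∷ R₃) , ≤-trans (length-++-≤ˡ D₁) inner) ,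
      (D₁ ++ q ∷ D₂ , R₃ ++ rs , trans (cong (λ m → ls ++ (D₀ ++ p ∷ m) ++ rs) regroup) (split (D₁ ++ q ∷ D₂) (r ∷ R₃)) ,
        ≤-trans (length-++-≤ˡ (D₁ ++ q ∷ D₂)) (≤-trans (≤-reflexive (cong length (sym regroup))) inner))
      where
      regroup : D₁ ++ q ∷ D₂ ++ r ∷ R₃ ≡ (D₁ ++ q ∷ D₂) ++ r ∷ R₃
      regroup = sym (++-assoc D₁ (q ∷ D₂) (r ∷ R₃))
      inner : length (D₁ ++ q ∷ D₂ ++ r ∷ R₃) ≤ d
      inner = ≤-trans (≤-trans (n≤1+n _) (length-++-≤ʳ (p ∷ D₁ ++ q ∷ D₂ ++ r ∷ R₃) {D₀})) short
      split : ∀ D T → ls ++ (D₀ ++ p ∷ D ++ T) ++ rs ≡ (ls ++ D₀) ++ p ∷ D ++ T ++ rs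
      split D T = trans (cong (ls ++_) (trans (++-assoc D₀ (p ∷ D ++ T) rs) (cong (λ m → D₀ ++ p ∷ m) (++-assoc D T rs))))
        (sym (++-assoc ls D₀ _))
      q≢r : q ≢ r
      q≢r with proj₁ (proj₂ (Unique-++⁻ ls u))
      ... | u₁ with proj₁ (proj₂ (Unique-++⁻ D₀ (proj₁ (Unique-++⁻ (D₀ ++ p ∷ D₁ ++ q ∷ D₂ ++ r ∷ R₃) u₁))))
      ... | _ ∷ u₂ with proj₁ (proj₂ (Unique-++⁻ D₁ u₂))
      ... | q∉ ∷ _ = All.lookup q∉ (∈-++⁺ʳ D₂ (here refl))

  -- The distinguished path has k vertices, and f vertices lie in t other paths.
  record Room (g k f t : ℕ) : Set where
    field
      short : 4 * k < 3 * (k + f)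
      few : 16 * g * t ≤ k + f
      large : 20000 * suc g ≤ k + f

  -- Enlarging the distinguished path v ∷ P₀.  Most outside vertices x lie deep inside another path,
  -- and the colour of x v must occur on v ∷ P₀, say on the arc leaving a; so many arcs of the path can be
  -- traded for a long detour through x.  Two such arcs that are close together and whose tails a, b have
  -- common (or close) neighbours in new colours let us close the path up again at bounded cost.
  module Enlarge {n : ℕ} (c : Fin n → Fin n → ℕ)
    (c-sym : ∀ u v → c u v ≡ c v u)
    (c-inj : ∀ {u v w} → u ≢ v → u ≢ w → c u v ≡ c u w → v ≡ w) where

    open PathSystem c c-sym

    private
      V = Fin n

    -- A detour gives up two stretches of the old path, of at most 32 and 700 vertices, well within
    -- 1000. The 8 leaves room for the leftover pieces and for three colour cuts.
    Enlarged : ℕ → List V → List (List V) → Set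
    Enlarged g P F = ∃₂ λ P′ F′ → PathSystem (P′ ∷ F′) × length (concat (P′ ∷ F′)) ≡ length (concat (P ∷ F)) ×
      length P + g ≤ length P′ + 1000 × length F′ ≤ length F + 8

    module _ (g : ℕ) (v : V) (P₀ : List V) (F : List (List V)) (sys : PathSystem ((v ∷ P₀) ∷ F)) where

      P : List V
      P = v ∷ P₀

      P-unique : Unique P
      P-unique = proj₁ (Unique-++⁻ P (proj₁ sys))

      off-path : ∀ {x} → x ∈ P → x ∉ concat F
      off-path = proj₂ (proj₂ (Unique-++⁻ P (proj₁ sys)))

      record Deep (x : V) : Set where
        field
          Q₁ Q₂ : List V
          F₀ : List (List V)
          perm : F ↭ (Q₁ ++ x ∷ Q₂) ∷ F₀
          Q₁-long : g ≤ length Q₁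
          Q₂-long : g ≤ length Q₂

        size : length F ≡ suc (length F₀)
        size = ↭-length perm

        outside : x ∈ concat F
        outside = ∈-resp-↭ (concat-↭ (↭-sym perm)) (∈-++⁺ˡ (∈-++⁺ʳ Q₁ (here refl)))

        v≢x : v ≢ x
        v≢x refl = off-path (here refl) outside

        private
          colours-parts = Unique-++⁻ (ec P) (proj₂ (⊒-system (⊒-∷ P (⊒-↭ perm)) sys))

        colours-unique : Unique (ec (Q₁ ++ x ∷ Q₂))
        colours-unique = proj₁ (Unique-++⁻ (ec (Q₁ ++ x ∷ Q₂)) (proj₁ (proj₂ colours-parts)))

        colours-disjoint : ∀ {γ} → γ ∈ ec P → γ ∉ ec (Q₁ ++ x ∷ Q₂)
        colours-disjoint γ∈ γ∈Q = proj₂ (proj₂ colours-parts) γ∈ (∈-++⁺ˡ γ∈Q)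

      attach : ∀ {h x U} G → P ∷ F ⊒ U ∷ P ∷ G → Ends h x U → c x v ∉ ec U → c x v ∉ ec P →
        length G ≤ suc (length F) → g ≤ length U → Enlarged g P F
      attach {U = U} G ref eU ∉U ∉P lenG lenU
        with join [] G (⊒-system ref sys) eU (Ends-∷ v P₀)
               ([ ∉U , [ ∉P , (λ ()) ]′ ∘ ∈-++⁻ (ec P) ]′ ∘ ∈-++⁻ (ec U))
      ... | F′ , sys′ , len , vs = U ++ P , F′ , sys′ ,
        trans (↭-length vs) (sym (↭-length (_⊒_.verts ref))) ,
        ≤-trans (≤-reflexive (+-comm (length P) g)) (≤-trans (+-monoˡ-≤ (length P) lenU)
          (≤-trans (≤-reflexive (sym (length-++ U))) (m≤m+n _ 1000))) ,
        ≤-trans len (≤-trans (s≤s lenG) (≤-trans (≤-reflexive (+-comm 2 (length F))) (+-monoʳ-≤ (length F) (m≤m+n 2 6))))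

      -- The colour of the edge from `x` to `v` occurs on at most one side of `x` in its path, so
      -- the other side, with at least `g` vertices, can be put in front of P. This is why `Deep`
      -- asks for length on both sides.
      attach-deep : ∀ {x} → Deep x → c x v ∉ ec P → Enlarged g P F
      attach-deep {x} d ∉P with mem? _≟_ (c x v) (ec (x ∷ Deep.Q₂ d))
      ... | no ∉Q = attach (Q₁ ∷ F₀) ref (Ends-reverse (Ends-∷ x Q₂)) (∉Q ∘ ∈-resp-↭ (ec-reverse (x ∷ Q₂))) ∉P
          (s≤s (≤-trans (n≤1+n _) (≤-reflexive (sym size))))
          (≤-trans Q₂-long (≤-trans (n≤1+n _) (≤-reflexive (sym (length-reverse (x ∷ Q₂))))))
        where
        open Deep d
        ref : P ∷ F ⊒ reverse (x ∷ Q₂) ∷ P ∷ Q₁ ∷ F₀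
        ref = ⊒-trans (⊒-∷ P (⊒-trans (⊒-↭ perm) (⊒-cut Q₁ (x ∷ Q₂))))
          (⊒-trans (⊒-↭ (shift (x ∷ Q₂) (P ∷ Q₁ ∷ []) F₀)) (⊒-reverse (x ∷ Q₂)))
      ... | yes ∈Q = attach (Q₂ ∷ F₀) ref (proj₂ (last-end Q₁)) ∉Q₁ ∉P
          (s≤s (≤-trans (n≤1+n _) (≤-reflexive (sym size))))
          (≤-trans Q₁-long (length-++-≤ˡ Q₁))
        where
        open Deep d
        last-end : ∀ xs → ∃ λ h → Ends h x (xs ++ x ∷ [])
        last-end [] = x , [] , refl , refl
        last-end (y ∷ ys) = y , Ends-mid ys
        ref : P ∷ F ⊒ (Q₁ ++ x ∷ []) ∷ P ∷ Q₂ ∷ F₀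
        ref = ⊒-trans (⊒-∷ P (⊒-trans (⊒-↭ perm)
                (subst (λ q → q ∷ F₀ ⊒ (Q₁ ++ x ∷ []) ∷ Q₂ ∷ F₀) (++-assoc Q₁ (x ∷ []) Q₂) (⊒-cut (Q₁ ++ x ∷ []) Q₂))))
              (⊒-↭ (swap _ _ refl))
        ∉Q₁ : c x v ∉ ec (Q₁ ++ x ∷ [])
        ∉Q₁ p = proj₂ (proj₂ (Unique-++⁻ (ec (Q₁ ++ x ∷ [])) (subst Unique (ec-mid Q₁ x Q₂) colours-unique))) p ∈Q

      -- Adding the edge from `x` to `v` costs the equally coloured edge from `a` to `b`. A walk
      -- that enters P at `v` then stops at `a`, which needs a new way on.
      record Anchor (a : V) : Set where
        field
          x : V
          deep : Deep x
          pre post : List V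
          b : V
          split : P ≡ pre ++ a ∷ b ∷ post
          colour≡ : c a b ≡ c x v

        open Deep deep public

        -- Truncated to `g + 1` vertices, so that the pieces of five anchors block only O(g)
        -- vertices and colours.
        piece : List V
        piece = x ∷ take g Q₂

        piece-length : length piece ≡ suc g
        piece-length = cong suc (trans (length-take g Q₂) (m≤n⇒m⊓n≡m Q₂-long))

        colours-split : ec P ≡ ec (pre ++ a ∷ []) ++ c x v ∷ ec (b ∷ post)
        colours-split = trans (cong ec split) (trans (ec-mid pre a (b ∷ post))
          (cong (λ γ → ec (pre ++ a ∷ []) ++ γ ∷ ec (b ∷ post)) colour≡))

        on-path : c x v ∈ ec P
        on-path = subst (c x v ∈_) (sym colours-split) (∈-++⁺ʳ (ec (pre ++ a ∷ [])) (here refl))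

        -- P is rainbow, so its only edge with this colour is the one leaving `a`, which lies in
        -- neither of the two parts.
        freed : ∀ pre′ rest → P ≡ pre′ ++ a ∷ rest → c x v ∉ ec (pre′ ++ a ∷ []) × c x v ∉ ec rest
        freed pre′ rest eq with split-unique pre pre′ (subst Unique split P-unique) (trans (sym split) eq)
        ... | refl , refl with Unique-++⁻ (ec (pre ++ a ∷ [])) (subst Unique colours-split (proj₁ (Unique-++⁻ (ec P) (proj₂ sys))))
        ... | _ , γ∉ ∷ _ , dis = (λ p → dis p (here refl)) , λ p → All.lookup γ∉ p refl

        cut-piece : F ⊒ Q₁ ∷ piece ∷ drop g Q₂ ∷ F₀
        cut-piece = ⊒-trans (⊒-↭ perm) (⊒-trans (⊒-cut Q₁ (x ∷ Q₂)) (⊒-∷ Q₁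
          (subst (λ q → q ∷ F₀ ⊒ piece ∷ drop g Q₂ ∷ F₀) (cong (x ∷_) (take++drop≡id g Q₂)) (⊒-cut piece (drop g Q₂)))))

        piece-colours : ∀ {γ} → γ ∈ ec P → γ ∉ ec piece
        piece-colours γ∈ γ∈p = colours-disjoint γ∈ (ec-++ʳ Q₁ (x ∷ Q₂)
          (subst (λ q → _ ∈ ec (x ∷ q)) (take++drop≡id g Q₂) (ec-++ˡ piece (drop g Q₂) γ∈p)))

      -- Detours through an anchor.

      Fresh : ∀ {a} → Anchor a → ℕ → Set
      Fresh anc γ = γ ∉ ec P × γ ∉ ec (Anchor.piece anc)

      ec-contiguous : ∀ X Y Z {γ} → γ ∈ ec Y → γ ∈ ec (X ++ Y ++ Z)
      ec-contiguous X Y Z = ec-++ʳ X (Y ++ Z) ∘ ec-++ˡ Y Z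

      private
        detour-length : ∀ (X A C E : List V) → length X ≡ suc g → length P ≤ length A + length C + length E + 1000 →
          length P + g ≤ length (((X ++ A) ++ C) ++ E) + 1000
        detour-length X A C E lenX lenP = ≤-trans (linear 1 lenP (eq (length P) g (length A) (length C) (length E) 1000))
          (≤-reflexive (cong (_+ 1000) (sym len≡)))
          where
          len≡ : length (((X ++ A) ++ C) ++ E) ≡ suc g + length A + length C + length E
          len≡ = trans (length-++ ((X ++ A) ++ C)) (cong (_+ length E)
            (trans (length-++ (X ++ A)) (cong (_+ length C)
              (trans (length-++ X) (cong (_+ length A) lenX)))))
          eq : ∀ p g a c e k → p + g + (a + c + e + k) + 1 ≡ suc g + a + c + e + k + p
          eq = solve-∀

        outside-all : ∀ {γ} X A C E → γ ∉ ec X → γ ∉ ec A → γ ∉ ec C → γ ∉ ec E → γ ∉ colours (X ∷ A ∷ C ∷ E ∷ [])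
        outside-all X A C E X∉ A∉ C∉ E∉ = [ X∉ , [ A∉ , [ C∉ , [ E∉ , (λ ()) ]′ ∘ ∈-++⁻ (ec E) ]′ ∘ ∈-++⁻ (ec C) ]′ ∘ ∈-++⁻ (ec A) ]′ ∘ ∈-++⁻ (ec X)

      -- The new path follows `piece` backwards to `x`, crosses to `v`, and runs through `A`, `C`,
      -- `E`. The colour of the first crossing is available since its edge on P is left out; the
      -- other two crossings use colours absent from P and from `piece`.
      detour : ∀ {a a₁ c₀ c₁ e₀ e₁ A C E} (anc : Anchor a) G → let open Anchor anc in
        P ∷ F ⊒ piece ∷ A ∷ C ∷ E ∷ G →
        length G ≤ 5 + length F → length P ≤ length A + length C + length E + 1000 →
        Ends v a₁ A → Ends c₀ c₁ C → Ends e₀ e₁ E →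
        c x v ∉ ec A → c x v ∉ ec C → c x v ∉ ec E →
        (∀ {γ} → γ ∈ ec A → γ ∈ ec P) → (∀ {γ} → γ ∈ ec C → γ ∈ ec P) → (∀ {γ} → γ ∈ ec E → γ ∈ ec P) →
        Fresh anc (c a₁ c₀) → Fresh anc (c c₁ e₀) → c c₁ e₀ ≢ c a₁ c₀ → Enlarged g P F
      detour {A = A} {C} {E} anc G ref lenG lenP eA eC eE αA αC αE A⊆ C⊆ E⊆ (β∉P , β∉p) (γ∉P , γ∉p) γ≢β =
        finish (assemble G (⊒-system ref′ sys) (Ends-reverse (Ends-∷ x (take g Q₂))) eA eC eE
          (old∉ (piece-colours on-path) αA αC αE)
          (old∉ β∉p (β∉P ∘ A⊆) (β∉P ∘ C⊆) (β∉P ∘ E⊆))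
          (old∉ γ∉p (γ∉P ∘ A⊆) (γ∉P ∘ C⊆) (γ∉P ∘ E⊆))
          (λ e → β∉P (subst (_∈ ec P) (sym e) on-path))
          (λ e → γ∉P (subst (_∈ ec P) (sym e) on-path)) γ≢β)
        where
        open Anchor anc
        P′ = ((reverse piece ++ A) ++ C) ++ E
        ref′ : P ∷ F ⊒ reverse piece ∷ A ∷ C ∷ E ∷ G
        ref′ = ⊒-trans ref (⊒-reverse piece)
        old∉ : ∀ {γ} → γ ∉ ec piece → γ ∉ ec A → γ ∉ ec C → γ ∉ ec E →
          γ ∉ colours (reverse piece ∷ A ∷ C ∷ E ∷ [])
        old∉ p∉ = outside-all (reverse piece) A C E (p∉ ∘ ∈-resp-↭ (ec-reverse piece))
        finish : (∃ λ G′ → PathSystem (P′ ∷ G′) × length G′ ≤ 3 + length G ×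
          concat (P′ ∷ G′) ↭ concat (reverse piece ∷ A ∷ C ∷ E ∷ G)) → Enlarged g P F
        finish (F′ , sys′ , len , vs) = P′ , F′ , sys′ ,
          trans (↭-length vs) (sym (↭-length (_⊒_.verts ref′))) ,
          detour-length (reverse piece) A C E (trans (length-reverse piece) piece-length) lenP ,
          ≤-trans len (≤-trans (+-monoʳ-≤ 3 lenG) (≤-reflexive (+-comm 8 (length F))))

      -- The middle part `C` is traversed backwards, so only the short stretches `B` and `D` on both
      -- sides of it are lost.
      reroute : ∀ {a a₁ c₀ c₁ e₀ e₁} (anc : Anchor a) A B C D E → let open Anchor anc in
        P ≡ A ++ B ++ C ++ D ++ E → length B + length D ≤ 1000 →
        Ends v a₁ A → Ends c₁ c₀ C → Ends e₀ e₁ E →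
        c x v ∉ ec A → c x v ∉ ec C → c x v ∉ ec E →
        Fresh anc (c a₁ c₀) → Fresh anc (c c₁ e₀) → c c₁ e₀ ≢ c a₁ c₀ → Enlarged g P F
      reroute anc A B C D E eq lenBD eA eC eE αA αC αE =
        detour anc (B ∷ D ∷ Q₁ ∷ drop g Q₂ ∷ F₀) ref
          (+-monoʳ-≤ 3 (≤-trans (≤-reflexive (sym size)) (m≤n+m (length F) 2))) lenP eA (Ends-reverse eC) eE
          αA (αC ∘ ∈-resp-↭ (ec-reverse C)) αE
          (λ p → toP (ec-++ˡ A (B ++ C ++ D ++ E) p))
          (λ p → toP (ec-++ʳ A _ (ec-contiguous B C (D ++ E) (∈-resp-↭ (ec-reverse C) p))))
          (λ p → toP (ec-++ʳ A _ (ec-++ʳ B _ (ec-++ʳ C _ (ec-++ʳ D E p)))))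
        where
        open Anchor anc
        toP : ∀ {γ} → γ ∈ ec (A ++ B ++ C ++ D ++ E) → γ ∈ ec P
        toP = subst (λ p → _ ∈ ec p) (sym eq)
        cut₅ : ∀ G → P ∷ G ⊒ A ∷ B ∷ C ∷ D ∷ E ∷ G
        cut₅ G = subst (λ p → p ∷ G ⊒ A ∷ B ∷ C ∷ D ∷ E ∷ G) (sym eq)
          (⊒-trans (⊒-cut A (B ++ C ++ D ++ E)) (⊒-∷ A (⊒-trans (⊒-cut B (C ++ D ++ E))
            (⊒-∷ B (⊒-trans (⊒-cut C (D ++ E)) (⊒-∷ C (⊒-cut D E)))))))
        ref : P ∷ F ⊒ piece ∷ A ∷ reverse C ∷ E ∷ B ∷ D ∷ Q₁ ∷ drop g Q₂ ∷ F₀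
        ref = ⊒-trans (⊒-trans (⊒-∷ P cut-piece) (cut₅ _))
          (⊒-trans (⊒-↭ (↭-trans (shift C (A ∷ B ∷ []) _) (↭-prep C (↭-trans
              (shift piece (A ∷ B ∷ D ∷ E ∷ Q₁ ∷ []) _) (↭-prep piece (↭-prep A (shift E (B ∷ D ∷ []) _)))))))
            (⊒-trans (⊒-reverse C) (⊒-↭ (↭-sym (shift (reverse C) (piece ∷ A ∷ []) _)))))
        lenP : length P ≤ length A + length (reverse C) + length E + 1000
        lenP = linear 0 lenBD (trans (cong (λ k → k + 1000 + 0) (trans (cong length eq) len))
            (trans (eq′ (length A) (length B) (length C) (length D) (length E) 1000)
              (cong (λ k → length A + k + length E + 1000 + (length B + length D)) (sym (length-reverse C)))))
          where
          len : length (A ++ B ++ C ++ D ++ E) ≡ length A + (length B + (length C + (length D + length E)))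
          len = trans (length-++ A) (cong (length A +_) (trans (length-++ B) (cong (length B +_)
            (trans (length-++ C) (cong (length C +_) (length-++ D))))))
          eq′ : ∀ a b c d e k → a + (b + (c + (d + e))) + k + 0 ≡ a + c + e + k + (b + d)
          eq′ = solve-∀

      -- A single outside vertex `z`, isolated from its own path, bridges the gap `B`. It must avoid
      -- `piece`, which is already part of the new path.
      reroute-outside : ∀ {a a₁ e₀ e₁ z} (anc : Anchor a) A B E → let open Anchor anc in
        P ≡ A ++ B ++ E → length B ≤ 1000 → z ∈ concat F → z ∉ piece →
        Ends v a₁ A → Ends e₀ e₁ E → c x v ∉ ec A → c x v ∉ ec E →
        Fresh anc (c a₁ z) → Fresh anc (c z e₀) → c z e₀ ≢ c a₁ z → Enlarged g P F
      reroute-outside {z = z} anc A B E eq lenB z∈ z∉ eA eE αA αE =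
        detour anc (B ∷ proj₁ isolated) ref
          (s≤s (≤-trans (proj₂ (proj₂ isolated)) (s≤s (s≤s (≤-trans (≤-reflexive (sym size)) (m≤n+m (length F) 2))))))
          lenP eA ([] , refl , refl) eE αA (λ ()) αE
          (λ p → toP (ec-++ˡ A (B ++ E) p)) (λ ()) (λ p → toP (ec-++ʳ A _ (ec-++ʳ B E p)))
        where
        open Anchor anc
        toP : ∀ {γ} → γ ∈ ec (A ++ B ++ E) → γ ∈ ec P
        toP = subst (λ p → _ ∈ ec p) (sym eq)
        elsewhere : z ∈ concat (Q₁ ∷ drop g Q₂ ∷ F₀)
        elsewhere with ∈-++⁻ Q₁ (∈-resp-↭ (_⊒_.verts cut-piece) z∈)
        ... | inj₁ p = ∈-++⁺ˡ p
        ... | inj₂ p with ∈-++⁻ piece p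
        ... | inj₁ q = ⊥-elim (z∉ q)
        ... | inj₂ q = ∈-++⁺ʳ Q₁ q
        isolated = isolate z (Q₁ ∷ drop g Q₂ ∷ F₀) elsewhere
        cut₃ : ∀ G → P ∷ G ⊒ A ∷ B ∷ E ∷ G
        cut₃ G = subst (λ p → p ∷ G ⊒ A ∷ B ∷ E ∷ G) (sym eq) (⊒-trans (⊒-cut A (B ++ E)) (⊒-∷ A (⊒-cut B E)))
        ref : P ∷ F ⊒ piece ∷ A ∷ (z ∷ []) ∷ E ∷ B ∷ proj₁ isolated
        ref = ⊒-trans (⊒-trans (⊒-∷ P cut-piece) (cut₃ _))
          (⊒-trans (⊒-↭ (shift piece (A ∷ B ∷ E ∷ Q₁ ∷ []) _))
            (⊒-trans (⊒-++ (piece ∷ A ∷ B ∷ E ∷ []) (proj₁ (proj₂ isolated)))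
              (⊒-↭ (↭-prep piece (↭-prep A (↭-trans (shift (z ∷ []) (B ∷ E ∷ []) _) (↭-prep _ (swap B E refl))))))))
        lenP : length P ≤ length A + 1 + length E + 1000
        lenP = linear 1 lenB (trans (cong (λ k → k + 1000 + 1) (trans (cong length eq) len))
            (eq′ (length A) (length B) (length E) 1000))
          where
          len : length (A ++ B ++ E) ≡ length A + (length B + length E)
          len = trans (length-++ A) (cong (length A +_) (length-++ B))
          eq′ : ∀ a b e k → a + (b + e) + k + 1 ≡ a + 1 + e + k + b
          eq′ = solve-∀

      -- The guarded vertices and colours keep the links from interfering with the detours.
      module _ (as : List (Σ V Anchor)) where

        guardVertices : List V
        guardVertices = concatMap (Anchor.piece ∘ proj₂) as

        guardColours : List ℕ
        guardColours = ec P ++ concatMap (ec ∘ Anchor.piece ∘ proj₂) as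

        Link : Σ V Anchor → V → Set
        Link (a , _) w = w ≢ a × c a w ∉ guardColours × w ∉ guardVertices

        link? : ∀ α w → Dec (Link α w)
        link? (a , _) w = ¬? (w ≟ᶠ a) ×-dec ¬? (mem? _≟_ (c a w) guardColours) ×-dec ¬? (mem? _≟ᶠ_ w guardVertices)

        guardVertices-length : length guardVertices ≡ length as * suc g
        guardVertices-length = go as
          where
          go : ∀ bs → length (concatMap (Anchor.piece ∘ proj₂) bs) ≡ length bs * suc g
          go [] = refl
          go ((_ , anc) ∷ bs) = trans (length-++ (Anchor.piece anc)) (cong₂ _+_ (Anchor.piece-length anc) (go bs))

        guardColours-length : length guardColours ≤ length P + length as * suc g
        guardColours-length = ≤-trans (≤-reflexive (length-++ (ec P))) (+-mono-≤ (ec-length P) (go as))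
          where
          go : ∀ bs → length (concatMap (ec ∘ Anchor.piece ∘ proj₂) bs) ≤ length bs * suc g
          go [] = z≤n
          go ((_ , anc) ∷ bs) = ≤-trans (≤-reflexive (length-++ (ec (Anchor.piece anc))))
            (+-mono-≤ (≤-trans (ec-length (Anchor.piece anc)) (≤-reflexive (Anchor.piece-length anc))) (go bs))

        fresh : ∀ {α β w} → α ∈ as → Link β w → Fresh (proj₂ α) (c (proj₁ β) w)
        fresh α∈ (_ , ∉Γ , _) = ∉Γ ∘ ∈-++⁺ˡ , λ p → ∉Γ (∈-++⁺ʳ (ec P)
          (∈-concatMap⁺ (ec ∘ Anchor.piece ∘ proj₂) (Any.map (λ { refl → p }) α∈)))

        -- A non-link is `a` itself, a guarded vertex, or a vertex joined to `a` in a guarded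
        -- colour; properness allows one of the last kind per colour.
        many-links : ∀ α {ys} → Unique ys →
          length ys ≤ count (link? α) ys + (1 + (length guardColours + length guardVertices))
        many-links α@(a , _) {ys} u = ≤-trans (≤-reflexive (sym (count-¬ (link? α) ys)))
          (+-monoʳ-≤ (count (link? α) ys) (≤-trans
            (count-⊎ (¬? ∘ link? α) (_≟ᶠ a) (λ w → coloured? w ⊎-dec guarded? w) reason ys)
            (+-mono-≤ (unique-length {ys = a ∷ []} (UniqueP.filter⁺ (_≟ᶠ a) u) λ p → here (proj₂ (∈-filter⁻ (_≟ᶠ a) {xs = ys} p)))
              (≤-trans (count-⊎ (λ w → coloured? w ⊎-dec guarded? w) coloured? guarded? id ys) (+-mono-≤
                (injective-length (c a) (UniqueP.filter⁺ coloured? u)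
                  (λ p → proj₂ (proj₂ (∈-filter⁻ coloured? {xs = ys} p)))
                  (λ p q → c-inj (proj₁ (proj₂ (∈-filter⁻ coloured? {xs = ys} p)) ∘ sym)
                                 (proj₁ (proj₂ (∈-filter⁻ coloured? {xs = ys} q)) ∘ sym)))
                (unique-length (UniqueP.filter⁺ guarded? u) λ p → proj₂ (∈-filter⁻ guarded? {xs = ys} p)))))))
          where
          coloured? : ∀ w → Dec (w ≢ a × c a w ∈ guardColours)
          coloured? w = ¬? (w ≟ᶠ a) ×-dec mem? _≟_ (c a w) guardColours
          guarded? : ∀ w → Dec (w ∈ guardVertices)
          guarded? w = mem? _≟ᶠ_ w guardVertices
          reason : ∀ {w} → ¬ Link α w → w ≡ a ⊎ (w ≢ a × c a w ∈ guardColours) ⊎ w ∈ guardVertices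
          reason {w} ¬l with w ≟ᶠ a | mem? _≟_ (c a w) guardColours | guarded? w
          ... | yes e | _ | _ = inj₁ e
          ... | no w≢ | yes p | _ = inj₂ (inj₁ (w≢ , p))
          ... | no w≢ | no p | yes q = inj₂ (inj₂ q)
          ... | no w≢ | no p | no q = ⊥-elim (¬l (w≢ , p , q))

        module _ {a b} (anc : Anchor a) (α∈ : (a , anc) ∈ as) (anc′ : Anchor b)
          {Lf M Rt} (eq : P ≡ Lf ++ a ∷ M ++ b ∷ Rt) (M-short : length M ≤ 32) where

          open Anchor anc using (x; piece)

          private
            Common : V → Set
            Common w = Link (a , anc) w × Link (b , anc′) w

            eP : Ends v (end v P₀) (Lf ++ a ∷ M ++ b ∷ Rt)
            eP = subst (Ends v (end v P₀)) eq (Ends-∷ v P₀)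

            left-free : c x v ∉ ec (Lf ++ a ∷ [])
            left-free = proj₁ (Anchor.freed anc Lf (M ++ b ∷ Rt) eq)

            right-free : c x v ∉ ec (M ++ b ∷ Rt)
            right-free = proj₂ (Anchor.freed anc Lf (M ++ b ∷ Rt) eq)

          via-outside : ∀ {z} → z ∈ concat F → Common z → Enlarged g P F
          via-outside {z} z∈ (la , lb) = reroute-outside anc (Lf ++ a ∷ []) M (b ∷ Rt)
            (trans eq (sym (++-assoc Lf (a ∷ []) (M ++ b ∷ Rt)))) (≤-trans M-short (m≤m+n 32 968)) z∈
            (λ p → proj₂ (proj₂ la) (∈-concatMap⁺ (Anchor.piece ∘ proj₂) (Any.map (λ { refl → p }) α∈)))
            (Ends-prefix Lf eP) (Ends-∷ b Rt) left-free (right-free ∘ ec-++ʳ M (b ∷ Rt))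
            (fresh {β = a , anc} α∈ la) (subst (Fresh anc) (c-sym b z) (fresh {β = b , anc′} α∈ lb))
            (λ e → a≢b (c-inj (proj₁ la) (proj₁ lb) (trans (c-sym z a) (sym e))))
            where
            a≢b : a ≢ b
            a≢b with proj₁ (proj₂ (Unique-++⁻ Lf (subst Unique eq P-unique)))
            ... | a∉ ∷ _ = All.lookup a∉ (∈-++⁺ʳ M (here refl))

          -- The order is: from `v` to `a`, across to `p`, back to `b`, across to `w`, on to the
          -- end. The vertices strictly between `a` and `b` and between `p` and `w` are lost.
          via-right : ∀ {X p D w T} → Rt ≡ X ++ p ∷ D ++ w ∷ T → length D ≤ 700 →
            Link (a , anc) p → Link (b , anc′) w → c b w ≢ c a p → Enlarged g P F
          via-right {X} {p} {D} {w} {T} refl D-short la lb = reroute anc (Lf ++ a ∷ []) M ((b ∷ X) ++ p ∷ []) D (w ∷ T)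
            (trans eq (sym (trans (++-assoc Lf (a ∷ []) _) (cong (λ r → Lf ++ a ∷ M ++ b ∷ r) (++-assoc X (p ∷ []) (D ++ w ∷ T))))))
            (≤-trans (+-mono-≤ M-short D-short) (m≤m+n 732 268))
            (Ends-prefix Lf eP) (Ends-mid X) (Ends-∷ w T) left-free
            (right-free ∘ ec-++ʳ M _ ∘ subst (λ r → _ ∈ ec (b ∷ r)) (++-assoc X (p ∷ []) (D ++ w ∷ T))
              ∘ ec-++ˡ ((b ∷ X) ++ p ∷ []) (D ++ w ∷ T))
            (right-free ∘ ec-++ʳ M _ ∘ ec-++ʳ (b ∷ X) _ ∘ ec-++ʳ (p ∷ D) (w ∷ T))
            (fresh {β = a , anc} α∈ la) (fresh {β = b , anc′} α∈ lb)

          -- The mirror image: from `v` to `p`, across to `a`, back to `w`, across to `b`, on to the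
          -- end.
          via-left : ∀ {X p D w T} → Lf ≡ X ++ p ∷ D ++ w ∷ T → length D ≤ 700 →
            Link (a , anc) p → Link (b , anc′) w → c b w ≢ c a p → Enlarged g P F
          via-left {X} {p} {D} {w} {T} refl D-short la lb ne = reroute anc (X ++ p ∷ []) D ((w ∷ T) ++ a ∷ []) M (b ∷ Rt)
            eq₅ (≤-trans (+-mono-≤ D-short M-short) (m≤m+n 732 268))
            (Ends-prefix X {D ++ w ∷ T ++ a ∷ M ++ b ∷ Rt} (subst (Ends v (end v P₀)) eq₄ eP)) (Ends-mid T) (Ends-∷ b Rt)
            (left-free ∘ subst (λ r → _ ∈ ec r) eq₃ ∘ ec-++ˡ (X ++ p ∷ []) (D ++ w ∷ T ++ a ∷ []))
            (left-free ∘ subst (λ r → _ ∈ ec r) eq₃ ∘ ec-++ʳ (X ++ p ∷ []) _ ∘ ec-++ʳ D (w ∷ T ++ a ∷ []))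
            (right-free ∘ ec-++ʳ M (b ∷ Rt))
            (subst (Fresh anc) (c-sym a p) (fresh {β = a , anc} α∈ la)) (subst (Fresh anc) (c-sym b w) (fresh {β = b , anc′} α∈ lb))
            (λ e → ne (trans (c-sym b w) (trans e (c-sym p a))))
            where
            eq₄ : (X ++ p ∷ D ++ w ∷ T) ++ a ∷ M ++ b ∷ Rt ≡ X ++ p ∷ D ++ w ∷ T ++ a ∷ M ++ b ∷ Rt
            eq₄ = trans (++-assoc X (p ∷ D ++ w ∷ T) _) (cong (λ r → X ++ p ∷ r) (++-assoc D (w ∷ T) _))
            eq₃ : (X ++ p ∷ []) ++ D ++ w ∷ T ++ a ∷ [] ≡ (X ++ p ∷ D ++ w ∷ T) ++ a ∷ []
            eq₃ = trans (++-assoc X (p ∷ []) _) (sym (trans (++-assoc X (p ∷ D ++ w ∷ T) _) (cong (λ r → X ++ p ∷ r) (++-assoc D (w ∷ T) _))))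
            eq₅ : P ≡ (X ++ p ∷ []) ++ D ++ ((w ∷ T) ++ a ∷ []) ++ M ++ b ∷ Rt
            eq₅ = trans eq (trans eq₄ (sym (trans (++-assoc X (p ∷ []) _)
              (cong (λ r → X ++ p ∷ D ++ w ∷ r) (++-assoc T (a ∷ []) (M ++ b ∷ Rt))))))

      -- A deep vertex whose colour to `v` misses P can be attached at once; every other one yields
      -- an anchor. Distinct deep vertices have distinct colours to `v`, hence distinct edges of P
      -- and distinct tails.
      anchors : ∀ xs → Unique xs → (∀ {x} → x ∈ xs → Deep x) → Enlarged g P F ⊎
        ∃ λ (as : List (Σ V Anchor)) → length as ≡ length xs × Unique (map proj₁ as) ×
          (∀ {α} → α ∈ as → Anchor.x (proj₂ α) ∈ xs)
      anchors [] _ _ = inj₂ ([] , refl , [] , λ ())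
      anchors (x ∷ xs) (x∉ ∷ u) deep with anchors xs u (deep ∘ there) | mem? _≟_ (c x v) (ec P)
      ... | inj₁ done | _ = inj₁ done
      ... | inj₂ _ | no new = inj₁ (attach-deep (deep (here refl)) new)
      ... | inj₂ (as , len , uas , origin) | yes old with ec∈⇒split P old
      ... | pre , a , b , post , split , colour≡ = inj₂ ((a , anc) ∷ as , cong suc len ,
          AllP.map⁺ (All.tabulate λ α∈ → distinct α∈) ∷ uas ,
          λ { (here refl) → here refl ; (there p) → there (origin p) })
        where
        anc : Anchor a
        anc = record { x = x ; deep = deep (here refl) ; pre = pre ; post = post ; b = b ; split = split ; colour≡ = colour≡ }
        distinct : ∀ {α} → α ∈ as → a ≢ proj₁ α
        distinct {_ , anc′} α∈ refl with split-unique pre (Anchor.pre anc′) (subst Unique split P-unique)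
                                            (trans (sym split) (Anchor.split anc′))
        ... | refl , refl = All.lookup x∉ (origin α∈) (c-inj (Deep.v≢x (deep (here refl))) (Anchor.v≢x anc′)
                (trans (c-sym v x) (trans (sym colour≡) (trans (Anchor.colour≡ anc′) (c-sym (Anchor.x anc′) v)))))

      deep-vertex : ∀ {x} → x ∈ concatMap (interior g) F → Deep x
      deep-vertex x∈ with find (∈-concatMap⁻ (interior g) {xs = F} x∈)
      ... | Q , Q∈ , x∈Q with interior-split g Q x∈Q | ∈-∃↭ Q∈
      ... | Q₁ , Q₂ , refl , l₁ , l₂ | F₀ , perm =
        record { Q₁ = Q₁ ; Q₂ = Q₂ ; F₀ = F₀ ; perm = perm ; Q₁-long = l₁ ; Q₂-long = l₂ }

      -- Existence of a detour by counting.

      module _ (room : Room g (length P) (length (concat F)) (length F)) where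

        private
          k = length P
          f = length (concat F)

          open Room room

          k<3f : suc k ≤ 3 * f
          k<3f = linear 0 short (eq k f)
            where
            eq : ∀ k f → suc k + 3 * (k + f) + 0 ≡ 3 * f + suc (4 * k)
            eq = solve-∀

          f-large : 5000 * suc g ≤ f
          f-large = *-cancelˡ-≤ 4 (linear 1 (+-mono-≤ large k<3f) (eq k f g))
            where
            eq : ∀ k f g → 4 * (5000 * suc g) + (k + f + 3 * f) + 1 ≡ 4 * f + (20000 * suc g + suc k)
            eq = solve-∀

          5000≤f : 5000 ≤ f
          5000≤f = ≤-trans (m≤m*n 5000 (suc g)) f-large

          -- By `few` the ends of paths cost at most 2g per path, in total less than f/2, so `d`
          -- exceeds f/2. Then 32d > 16f, whereas 4k < 12f; this puts five anchors into some window
          -- of 32 vertices.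
          deep-many : ∀ {d} → f ≤ d + length F * (g + g) → 4 * (k + 32) < d * 32
          deep-many {d} h = linear 4879
            (+-mono-≤ (+-mono-≤ (*-monoʳ-≤ 32 h) (*-monoʳ-≤ 4 few)) (+-mono-≤ (*-monoʳ-≤ 8 k<3f) (+-mono-≤ 5000≤f (z≤n {3 * f}))))
            (eq k f g d (length F))
            where
            eq : ∀ k f g d t → suc (4 * (k + 32)) + (32 * (d + t * (g + g)) + 4 * (k + f) + (8 * (3 * f) + (f + 3 * f))) + 4879
              ≡ d * 32 + (32 * f + 4 * (16 * g * t) + (8 * suc k + (5000 + 0)))
            eq = solve-∀

          abstract
            ν τ : ℕ
            -- Of all k + f vertices, subtract the anchor itself, at most k for the colours of P,
            -- and 5(g + 1) twice for the vertices and the colours of five pieces.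
            ν = f ∸ (11 + 10 * g)
            -- Linear in `f`, yet small enough that the overlap term 25τ of `two-meet` is at most
            -- f/2.
            τ = f / 50

            ν-def : ν + (11 + 10 * g) ≡ f
            ν-def = m∸n+n≡m {f} {11 + 10 * g} (linear (4989 + 4990 * g) f-large (eq f g))
              where
              eq : ∀ f g → 11 + 10 * g + f + (4989 + 4990 * g) ≡ f + 5000 * suc g
              eq = solve-∀

            τ≤ : τ * 50 ≤ f
            τ≤ = m/n*n≤m f 50

            τ> : f < suc τ * 50
            τ> = ≤-trans (≤-reflexive (cong suc (m≡m%n+[m/n]*n f 50))) (+-monoˡ-≤ (τ * 50) (m%n<n f 50))

        links-many : (as : List (Σ V Anchor)) → length as ≡ 5 → ∀ α →
          ν ≤ count (link? as α) (P ++ concat F)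
        links-many as len α = linear {x = ν} {y = count (link? as α) (P ++ concat F)} 0 (+-mono-≤ (+-mono-≤ (≤-reflexive ν-def) (many-links as α (proj₁ sys)))
            (+-mono-≤ (guardColours-length as) (≤-reflexive (guardVertices-length as))))
          (trans (cong (λ m → ν + (f + (count (link? as α) (P ++ concat F) + (1 + (length (guardColours as) + length (guardVertices as)))) + (k + m * suc g + m * suc g)) + 0) len)
            (trans (eq ν f (count (link? as α) (P ++ concat F)) (length (guardColours as)) (length (guardVertices as)) k g)
              (cong (λ m → count (link? as α) (P ++ concat F) + (ν + (11 + 10 * g) + m + (length (guardColours as) + length (guardVertices as))))
                (sym (length-++ P)))))
          where
          eq : ∀ ν f d γ w k g → ν + (f + (d + (1 + (γ + w))) + (k + 5 * suc g + 5 * suc g)) + 0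
            ≡ d + (ν + (11 + 10 * g) + (k + f) + (γ + w))
          eq = solve-∀

        -- Here the number five and the bound 3/4 enter: the left side is below 4f + f/2, and 5ν is
        -- 5f up to a term in `g` that is tiny against `f`.
        links-meet : length (P ++ concat F) + 5 * 5 * τ < 5 * ν
        links-meet = subst (λ m → suc (m + 5 * 5 * τ) ≤ 5 * ν) (sym (length-++ P))
          (*-cancelˡ-≤ 2 (linear (4890 + 4900 * g)
            (+-mono-≤ (+-mono-≤ (*-monoʳ-≤ 2 k<3f) τ≤) (+-mono-≤ f-large (*-monoʳ-≤ 10 (≤-reflexive (sym ν-def)))))
            (eq k f g τ ν)))
          where
          eq : ∀ k f g τ ν → 2 * suc (k + f + 5 * 5 * τ) + (2 * (3 * f) + f + (f + 10 * (ν + (11 + 10 * g)))) + (4890 + 4900 * g)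
            ≡ 2 * (5 * ν) + (2 * suc k + τ * 50 + (5000 * suc g + 10 * f))
          eq = solve-∀

        -- Origin of the window 700: more than τ common links amount to over 14f after
        -- multiplication by 700, up to a constant, but sparseness on both sides allows only 2k <
        -- 6f, again up to a constant; f ≥ 5000 absorbs the constants.
        crowded : ∀ {l r cL cM cE cR} → τ < cL + (cM + cE) → cM ≤ 33 → cE ≤ suc cR → l + r ≤ k →
          cL * 700 ≤ 2 * (l + 700) → cR * 700 ≤ 2 * (r + 700) → ⊥
        crowded {l} {r} {cL} {cM} {cE} {cR} h₁ h₂ h₃ h₄ h₅ h₆ = 1+n≰n {0} (linear 13415
          (+-mono-≤ (+-mono-≤ (*-monoʳ-≤ 700 h₁) (+-mono-≤ (*-monoʳ-≤ 700 h₂) (*-monoʳ-≤ 700 h₃)))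
            (+-mono-≤ (+-mono-≤ h₅ h₆) (+-mono-≤ (+-mono-≤ (*-monoʳ-≤ 2 h₄) (*-monoʳ-≤ 2 k<3f))
              (+-mono-≤ (*-monoʳ-≤ 14 τ>) (*-monoʳ-≤ 8 5000≤f)))))
          (eq l r cL cM cE cR k f τ))
          where
          eq : ∀ l r cL cM cE cR k f τ →
            1 + (700 * (cL + (cM + cE)) + (700 * 33 + 700 * suc cR)
              + (2 * (l + 700) + 2 * (r + 700) + (2 * k + 2 * (3 * f) + (14 * (suc τ * 50) + 8 * f)))) + 13415
            ≡ 0 + (700 * suc τ + (700 * cM + 700 * cE)
              + (cL * 700 + cR * 700 + (2 * (l + r) + 2 * suc k + (14 * suc f + 8 * 5000))))
          eq = solve-∀

        -- A common link off P closes the gap directly. Otherwise all common links lie on P, at most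
        -- 33 of them from the first anchor up to the second, so they are dense to the left or to
        -- the right and three of them are close together.
        close-up : ∀ as {α β} → α ∈ as → ∀ {Lf M Rt} → P ≡ Lf ++ proj₁ α ∷ M ++ proj₁ β ∷ Rt → length M ≤ 32 →
          τ < count (λ w → link? as α w ×-dec link? as β w) (P ++ concat F) → Enlarged g P F
        close-up as {α@(a , anc)} {β@(b , anc′)} α∈ {Lf} {M} {Rt} eq M-short many
          with 0 <? count S? (concat F) | 2 * (length Lf + 700) <? count S? Lf * 700 | 2 * (length Rt + 700) <? count S? Rt * 700
          where
          S? = λ w → link? as α w ×-dec link? as β w
        ... | yes some | _ | _ = let (z , z∈ , both) = count>0 _ (concat F) some in
                via-outside as anc α∈ anc′ eq M-short z∈ both
        ... | no _ | yes dense | _ = pick (close-triple _ 700 Lf (proj₁ (Unique-++⁻ Lf (subst Unique eq P-unique))) dense)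
          where
          pick : CloseTriple (λ w → Link as α w × Link as β w) 700 Lf → Enlarged g P F
          pick (X , p , q , r , (lp , _) , (_ , lq) , (_ , lr) , q≢r , (D , T , e , D≤) , (D′ , T′ , e′ , D′≤)) with c b q ≟ c a p
          ... | no ne = via-left as anc α∈ anc′ eq M-short e D≤ lp lq ne
          ... | yes ce = via-left as anc α∈ anc′ eq M-short e′ D′≤ lp lr
                  (λ ce′ → q≢r (c-inj (proj₁ lq ∘ sym) (proj₁ lr ∘ sym) (trans ce (sym ce′))))
        ... | no _ | no _ | yes dense = pick (close-triple _ 700 Rt Rt-unique dense)
          where
          Rt-unique : Unique Rt
          Rt-unique = proj₁ (proj₂ (Unique-++⁻ (Lf ++ a ∷ M ++ b ∷ []) (subst Unique (trans eq (sym
            (trans (++-assoc Lf (a ∷ M ++ b ∷ []) Rt) (cong (λ m → Lf ++ a ∷ m) (++-assoc M (b ∷ []) Rt))))) P-unique)))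
          pick : CloseTriple (λ w → Link as α w × Link as β w) 700 Rt → Enlarged g P F
          pick (X , p , q , r , (lp , _) , (_ , lq) , (_ , lr) , q≢r , (D , T , e , D≤) , (D′ , T′ , e′ , D′≤)) with c b q ≟ c a p
          ... | no ne = via-right as anc α∈ anc′ eq M-short e D≤ lp lq ne
          ... | yes ce = via-right as anc α∈ anc′ eq M-short e′ D′≤ lp lr
                  (λ ce′ → q≢r (c-inj (proj₁ lq ∘ sym) (proj₁ lr ∘ sym) (trans ce (sym ce′))))
        ... | no none | no sparse | no sparse′ = ⊥-elim (crowded
            {l = length Lf} {r = length Rt} {cL = count S? Lf} {cM = count S? (a ∷ M)} {cE = count S? (b ∷ Rt)} {cR = count S? Rt}
            (≤-trans many (≤-reflexive total))
            (≤-trans (length-filter S? (a ∷ M)) (s≤s M-short))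
            (≤-trans (≤-reflexive (count-++ S? (b ∷ []) Rt)) (+-monoˡ-≤ (count S? Rt) (length-filter S? (b ∷ []))))
            lengths (≮⇒≥ sparse) (≮⇒≥ sparse′))
          where
          S? = λ w → link? as α w ×-dec link? as β w
          total : count S? (P ++ concat F) ≡ count S? Lf + (count S? (a ∷ M) + count S? (b ∷ Rt))
          total = trans (count-++ S? P (concat F)) (trans (cong₂ _+_ (trans (cong (count S?) eq)
              (trans (count-++ S? Lf _) (cong (count S? Lf +_) (count-++ S? (a ∷ M) (b ∷ Rt))))) (n≤0⇒n≡0 (≮⇒≥ none)))
            (+-identityʳ _))
          lengths : length Lf + length Rt ≤ k
          lengths = ≤-trans (+-monoʳ-≤ (length Lf) (≤-trans (n≤1+n _) (length-++-≤ʳ (b ∷ Rt) {a ∷ M})))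
            (≤-reflexive (sym (trans (cong length eq) (length-++ Lf))))

        enlarge : Enlarged g P F
        enlarge with anchors (concatMap (interior g) F)
                       (Unique-⊆ (concatMap-interior-⊆ g F) (proj₁ (proj₂ (Unique-++⁻ P (proj₁ sys))))) deep-vertex
        ... | inj₁ done = done
        -- Five anchors lie in one window of 32 vertices, so whichever two of them meet, the stretch
        -- of P between them is short enough to be given up.
        ... | inj₂ (as₀ , len₀ , u₀ , _) = from-cluster (cluster mark? 4 32 P
                (<-≤-trans (deep-many (concatMap-interior-length g F)) (*-monoˡ-≤ 32 marks)))
          where
          mark? = λ w → mem? _≟ᶠ_ w (map proj₁ as₀)
          marks : length (concatMap (interior g) F) ≤ count mark? P
          marks = ≤-trans (≤-reflexive (trans (sym len₀) (sym (length-map proj₁ as₀))))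
            (unique-length u₀ λ a∈ → ∈-filter⁺ mark? (tail∈ a∈) a∈)
            where
            tail∈ : ∀ {a} → a ∈ map proj₁ as₀ → a ∈ P
            tail∈ p with ∈-map⁻ proj₁ p
            ... | (_ , anc) , _ , refl = subst (_ ∈_) (sym (Anchor.split anc)) (∈-++⁺ʳ (Anchor.pre anc) (here refl))
          from-pair : ∀ ls M₁ M₂ M₃ rs as {α β} → P ≡ ls ++ (M₁ ++ proj₁ α ∷ M₂ ++ proj₁ β ∷ M₃) ++ rs →
            length (M₁ ++ proj₁ α ∷ M₂ ++ proj₁ β ∷ M₃) ≤ 32 → α ∈ as →
            τ < count (λ w → link? as α w ×-dec link? as β w) (P ++ concat F) → Enlarged g P F
          from-pair ls M₁ M₂ M₃ rs as {α} {β} eq ms-short α∈ many = close-up as {α} {β} α∈ {ls ++ M₁} {M₂} {M₃ ++ rs}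
              (trans eq regroup)
              (≤-trans (≤-trans (length-++-≤ˡ M₂) (≤-trans (n≤1+n _) (length-++-≤ʳ (proj₁ α ∷ M₂ ++ proj₁ β ∷ M₃) {M₁}))) ms-short)
              many
            where
            regroup : ls ++ (M₁ ++ proj₁ α ∷ M₂ ++ proj₁ β ∷ M₃) ++ rs ≡ (ls ++ M₁) ++ proj₁ α ∷ M₂ ++ proj₁ β ∷ M₃ ++ rs
            regroup = trans (cong (ls ++_) (trans (++-assoc M₁ _ rs) (cong (λ m → M₁ ++ proj₁ α ∷ m) (++-assoc M₂ _ rs))))
              (sym (++-assoc ls M₁ _))

          from-meeting : ∀ ls ms rs as → P ≡ ls ++ ms ++ rs → length ms ≤ 32 → map proj₁ as ⊆ ms →
            (∃₂ λ α β → α ∷ β ∷ [] ⊆ as × τ < count (λ w → link? as α w ×-dec link? as β w) (P ++ concat F)) →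
            Enlarged g P F
          from-meeting ls ms rs as eq ms-short as⊆ (α , β , αβ⊆ , many) with ⊆-∃++ (⊆-trans (SubP.map⁺ proj₁ αβ⊆) as⊆)
          ... | M₁ , _ , refl , β⊆ with ⊆-∃++ β⊆
          ... | M₂ , M₃ , refl , _ = from-pair ls M₁ M₂ M₃ rs as {α} {β} eq ms-short (Any-resp-⊆ αβ⊆ (here refl)) many

          from-cluster : (∃₂ λ ls ms → ∃₂ λ rs us → P ≡ ls ++ ms ++ rs × length ms ≤ 32 ×
            us ⊆ ms × length us ≡ 5 × All (_∈ map proj₁ as₀) us) → Enlarged g P F
          from-cluster (ls , ms , rs , us , eq , ms-short , us⊆ , len , marked) = go (map-∃ proj₁ marked)
            where
            go : (∃ λ as → map proj₁ as ≡ us) → Enlarged g P F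
            go (as , as≡) = from-meeting ls ms rs as eq ms-short (subst (_⊆ ms) (sym as≡) us⊆)
              (two-meet (Link as) (link? as) (P ++ concat F) ν τ as (λ {α} _ → links-many as len′ α)
                (subst (λ m → length (P ++ concat F) + m * m * τ < m * ν) (sym len′) links-meet))
              where
              len′ : length as ≡ 5
              len′ = trans (sym (length-map proj₁ as)) (trans (cong length as≡) len)

  -- Iterating the enlargement.

  scale : ℕ → ℕ
  scale zero = 1000
  scale (suc j) = scale j + scale j

  1000≤scale : ∀ j → 1000 ≤ scale j
  1000≤scale zero = ≤-refl
  1000≤scale (suc j) = ≤-trans (1000≤scale j) (m≤m+n (scale j) (scale j))

  module Growth {n : ℕ} (c : Fin n → Fin n → ℕ)
    (c-sym : ∀ u v → c u v ≡ c v u)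
    (c-inj : ∀ {u v w} → u ≢ v → u ≢ w → c u v ≡ c u w → v ≡ w) where

    open PathSystem c c-sym
    open Enlarge c c-sym c-inj

    module _ (N : ℕ) where

      record State (k t : ℕ) : Set where
        field
          path : List (Fin n)
          rest : List (List (Fin n))
          system : PathSystem (path ∷ rest)
          total : length (concat (path ∷ rest)) ≡ N
          nonempty : 0 < length path
          long : k ≤ length path
          few : length rest ≤ t

      open State

      Long : ∀ {k t} → State k t → Set
      Long s = 3 * N ≤ 4 * length (path s)

      Done : Set
      Done = ∃₂ λ k t → Σ (State k t) Long

      -- Pieces are taken of length parameter h + 1000 to make up for the 1000 vertices that may be
      -- lost. Since h ≥ 1000, it is at most 2h, and its successor at most 3h, which turns the 16
      -- and 20000 of `Room` into 32 and 60000.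
      step : ∀ {k t} h → 1000 ≤ h → h * 60000 ≤ N → h * 32 * t ≤ N → State k t → Done ⊎ State (k + h) (t + 8)
      step {k} {t} h h≥ h-small t-small s@record { path = v ∷ P₀ ; rest = F ; total = total } with 3 * N ≤? 4 * length (v ∷ P₀)
      ... | yes done = inj₁ (k , t , s , done)
      ... | no short = inj₂ (advance (enlarge (h + 1000) v P₀ F (system s) room))
        where
        size : N ≡ length (v ∷ P₀) + length (concat F)
        size = trans (sym total) (length-++ (v ∷ P₀))
        room : Room (h + 1000) (length (v ∷ P₀)) (length (concat F)) (length F)
        room = record
          { short = subst (λ m → 4 * length (v ∷ P₀) < 3 * m) size (≰⇒> short)
          ; few = subst (16 * (h + 1000) * length F ≤_) size (≤-trans
              (≤-trans (*-monoʳ-≤ (16 * (h + 1000)) (few s)) (*-monoˡ-≤ t (linear {x = 16 * (h + 1000)} {y = h * 32} 0 (*-monoʳ-≤ 16 h≥) (eq₁ h 1000)))) t-small)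
          ; large = subst (20000 * suc (h + 1000) ≤_) size (≤-trans
              (≤-trans (*-monoʳ-≤ 20000 (linear 0 (+-mono-≤ h≥ (≤-trans (m≤m+n 1 999) h≥)) (eq₂ h 1000))) (≤-reflexive (eq₃ 20000 3 h))) h-small) }
          where
          eq₁ : ∀ h m → 16 * (h + m) + 16 * h + 0 ≡ h * 32 + 16 * m
          eq₁ = solve-∀
          eq₂ : ∀ h m → suc (h + m) + (h + h) + 0 ≡ 3 * h + (m + 1)
          eq₂ = solve-∀
          eq₃ : ∀ a b h → a * (b * h) ≡ h * (a * b)
          eq₃ = solve-∀
        advance : Enlarged (h + 1000) (v ∷ P₀) F → State (k + h) (t + 8)
        advance (P′ , F′ , sys′ , total′ , long′ , few′) = record
          { path = P′ ; rest = F′ ; system = sys′ ; total = trans total′ total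
          ; nonempty = ≤-trans (nonempty s) (≤-trans (m≤m+n _ h) grown)
          ; long = ≤-trans (+-monoˡ-≤ h (long s)) grown
          ; few = ≤-trans few′ (+-monoˡ-≤ 8 (few s)) }
          where
          grown : length (v ∷ P₀) + h ≤ length P′
          grown = +-cancelʳ-≤ 1000 _ _ (≤-trans (≤-reflexive (+-assoc (length (v ∷ P₀)) h 1000)) long′)

      steps-many : ∀ u {k t} h → 1000 ≤ h → h * 60000 ≤ N → h * 32 * (t + u * 8) ≤ N → State k t →
        Done ⊎ State (k + u * h) (t + u * 8)
      steps-many zero {k} {t} h _ _ _ s = inj₂ (subst₂ State (sym (+-identityʳ k)) (sym (+-identityʳ t)) s)
      steps-many (suc u) {k} {t} h h≥ h-small t-small s
        with step h h≥ h-small (≤-trans (*-monoʳ-≤ (h * 32) (m≤m+n t _)) t-small) s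
      ... | inj₁ done = inj₁ done
      ... | inj₂ s′ with steps-many u h h≥ h-small (subst (λ m → h * 32 * m ≤ N) (sym (+-assoc t 8 (u * 8))) t-small) s′
      ... | inj₁ done = inj₁ done
      ... | inj₂ s″ = inj₂ (subst₂ State (+-assoc k h (u * h)) (+-assoc t 8 (u * 8)) s″)

      -- A step gains h vertices and costs at most 8 components, so N / (512 h) steps gain about N / 512
      -- vertices while the number of components stays below N / (32 h).
      phase : ∀ {k t} h → 1000 ≤ h → h * 60000 ≤ N → h * 64 * t ≤ N → State k t →
        Done ⊎ ∃₂ λ k′ t′ → State k′ t′ × k * 1024 + N ≤ k′ * 1024 × h * 32 * t′ ≤ N
      phase {k} {t} h h≥ h-small t-small s = conclude (steps-many u h h≥ h-small bound s)
        where
        instance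
          h≢0 : NonZero h
          h≢0 = >-nonZero (≤-trans (m≤m+n 1 999) h≥)
          h*512≢0 : NonZero (h * 512)
          h*512≢0 = m*n≢0 h 512
        u = N / (h * 512)
        bound : h * 32 * (t + u * 8) ≤ N
        bound = *-cancelˡ-≤ 2 (linear 0 (+-mono-≤ t-small (m/n*n≤m N (h * 512))) (eq h t u N 32 8))
          where
          eq : ∀ h t u N a b → 2 * (h * a * (t + u * b)) + (N + N) + 0 ≡ 2 * N + (h * (2 * a) * t + u * (h * (2 * (a * b))))
          eq = solve-∀
        N< : N < suc u * (h * 512)
        N< = ≤-trans (≤-reflexive (cong suc (m≡m%n+[m/n]*n N (h * 512)))) (+-monoˡ-≤ (u * (h * 512)) (m%n<n N (h * 512)))
        gain : k * 1024 + N ≤ (k + u * h) * 1024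
        gain = linear (2 + h * 58976) (+-mono-≤ (*-monoʳ-≤ 2 N<) h-small) (eq h k u N 512 58976)
          where
          eq : ∀ h k u N a b → k * (2 * a) + N + (2 * (suc u * (h * a)) + N) + (2 + h * b)
            ≡ (k + u * h) * (2 * a) + (2 * suc N + h * (2 * a + b))
          eq = solve-∀
        conclude : Done ⊎ State (k + u * h) (t + u * 8) →
          Done ⊎ ∃₂ λ k′ t′ → State k′ t′ × k * 1024 + N ≤ k′ * 1024 × h * 32 * t′ ≤ N
        conclude (inj₁ done) = inj₁ done
        conclude (inj₂ s′) = inj₂ (k + u * h , t + u * 8 , s′ , gain , bound)

      phases : ∀ j {k t} → scale j * 60000 ≤ N → scale j * 32 * t ≤ N → State k t →
        Done ⊎ ∃₂ λ k′ t′ → State k′ t′ × k * 1024 + j * N ≤ k′ * 1024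
      phases zero {k} {t} _ _ s = inj₂ (k , t , s , ≤-reflexive (+-identityʳ (k * 1024)))
      phases (suc j) {k} {t} large few s = continue (phase h (1000≤scale j) large′ few′ s)
        where
        h = scale j
        large′ : h * 60000 ≤ N
        large′ = ≤-trans (*-monoˡ-≤ 60000 {h} {h + h} (m≤m+n h h)) large
        few′ : h * 64 * t ≤ N
        few′ = ≤-trans (≤-reflexive (eq h 32 t)) few
          where
          eq : ∀ h a t → h * (2 * a) * t ≡ (h + h) * a * t
          eq = solve-∀
        conclude : ∀ {k′} → k * 1024 + N ≤ k′ * 1024 →
          Done ⊎ (∃₂ λ k″ t″ → State k″ t″ × k′ * 1024 + j * N ≤ k″ * 1024) →
          Done ⊎ ∃₂ λ k″ t″ → State k″ t″ × k * 1024 + suc j * N ≤ k″ * 1024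
        conclude _ (inj₁ done) = inj₁ done
        conclude {k′} gain (inj₂ (k″ , t″ , s″ , gain′)) = inj₂ (k″ , t″ , s″ ,
          linear 0 (+-mono-≤ gain gain′) (eq (k * 1024) (k′ * 1024) (k″ * 1024) N (j * N)))
          where
          eq : ∀ k k′ k″ N m → k + (N + m) + (k′ + k″) + 0 ≡ k″ + (k + N + (k′ + m))
          eq = solve-∀
        continue : Done ⊎ (∃₂ λ k′ t′ → State k′ t′ × k * 1024 + N ≤ k′ * 1024 × h * 32 * t′ ≤ N) →
          Done ⊎ ∃₂ λ k″ t″ → State k″ t″ × k * 1024 + suc j * N ≤ k″ * 1024
        continue (inj₁ done) = inj₁ done
        continue (inj₂ (k′ , t′ , s′ , gain , few″)) = conclude {k′} gain (phases j large′ few″ s′)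

      finish : ∀ j {k t} → 1024 ≤ j → scale j * 60000 ≤ N → scale j * 32 * t ≤ N → State k t → Done
      finish j {k} {t} j≥ large few s = conclude (phases j large few s)
        where
        conclude : Done ⊎ (∃₂ λ k′ t′ → State k′ t′ × k * 1024 + j * N ≤ k′ * 1024) → Done
        conclude (inj₁ done) = done
        conclude (inj₂ (k′ , t′ , s′ , gain)) = k′ , t′ , s′ ,
          *-mono-≤ {3} {4} (m≤m+n 3 1) (≤-trans (*-cancelʳ-≤ N k′ 1024
            (≤-trans (≤-reflexive (*-comm N 1024)) (≤-trans (*-monoˡ-≤ N j≥) (≤-trans (m≤n+m (j * N) (k * 1024)) gain)))) (long s′))

  abstract

    stages : ℕ
    stages = 1024

    1024≤stages : 1024 ≤ stages
    1024≤stages = ≤-refl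

  -- The initial linear forest has at most n / K components.
  K : ℕ
  K = scale stages * 60000

  threshold : ℕ
  threshold = K * suc (K * (2 * suc (4 * K)))

  0<K : 0 < K
  0<K = *-mono-≤ {1} {scale stages} (≤-trans (m≤m+n 1 999) (1000≤scale stages)) (m≤m+n 1 59999)

  rainbow-path : ∀ {n} → threshold < n → (c : Fin n → Fin n → ℕ) → IsEdgeColoring n c → IsProper n c →
    ∃ λ p → IsRainbowPath c p × 3 * n ≤ 4 * length p
  rainbow-path {n} big c symmetric proper = from-forest
    (few-components K 0<K (map (_, []) (allFin n)) (proj₁ singletons)
      (≤-trans (<⇒≤ big) (≤-reflexive (sym total₀))))
    where
    c-sym : ∀ u v → c u v ≡ c v u
    c-sym u v with u ≟ᶠ v
    ... | yes refl = refl
    ... | no u≢v = symmetric u v u≢v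

    c-inj : ∀ {u v w} → u ≢ v → u ≢ w → c u v ≡ c u w → v ≡ w
    c-inj {u} {v} {w} u≢v u≢w e with v ≟ᶠ w
    ... | yes v≡w = v≡w
    ... | no v≢w = ⊥-elim (proper u v w u≢v u≢w v≢w e)

    open Forest c c-sym c-inj
    open PathSystem c c-sym
    open Growth c c-sym c-inj

    total₀ : length (vertices (map (_, []) (allFin n))) ≡ n
    total₀ = trans (cong length (proj₂ singletons)) (length-tabulate id)

    colours-chains : ∀ G → colours (map (uncurry _∷_) G) ≡ map colour (arcs G)
    colours-chains [] = refl
    colours-chains ((x , xs) ∷ G) = trans (cong₂ _++_ (ec-steps x xs) (colours-chains G))
      (sym (map-++ colour (steps x xs) (arcs G)))

    from-state : Done n → ∃ λ p → IsRainbowPath c p × 3 * n ≤ 4 * length p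
    from-state (_ , _ , s , enough) = State.path s ,
      (proj₁ (Unique-++⁻ (State.path s) (proj₁ (State.system s))) ,
       proj₁ (Unique-++⁻ (ec (State.path s)) (proj₂ (State.system s)))) , enough

    from-forest : (∃ λ G → RainbowForest G × vertices G ↭ vertices (map (_, []) (allFin n)) ×
      K * length G ≤ length (vertices (map (_, []) (allFin n)))) → ∃ λ p → IsRainbowPath c p × 3 * n ≤ 4 * length p
    from-forest ([] , _ , perm , _) = ⊥-elim (<⇒≢ (≤-<-trans z≤n big) (trans (↭-length perm) total₀))
    from-forest (G@((x , xs) ∷ G′) , (uniqueV , uniqueC) , perm , few) = from-state
      (finish n stages {0} {length G′} 1024≤stages (≤-trans K≤threshold (<⇒≤ big)) few′ record
        { path = x ∷ xs ; rest = map (uncurry _∷_) G′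
        ; system = uniqueV , subst Unique (sym (colours-chains G)) uniqueC
        ; total = trans (↭-length perm) total₀
        ; nonempty = s≤s z≤n ; long = z≤n ; few = ≤-reflexive (length-map (uncurry _∷_) G′) })
      where
      K≤threshold : K ≤ threshold
      K≤threshold = m≤m*n K (suc (K * (2 * suc (4 * K))))
      few′ : scale stages * 32 * length G′ ≤ n
      few′ = ≤-trans (*-mono-≤ (*-monoʳ-≤ (scale stages) (m≤m+n 32 59968)) (n≤1+n (length G′)))
        (≤-trans few (≤-reflexive total₀))

  ratio-bound : ∀ ε → ℚ.Positive ε → ∀ n l → 3 * n ≤ 4 * l →
    ((ℤ.+ 3 ℚ./ 4) ℚ.- ε) ℚ.* (ℤ.+ n ℚ./ 1) ℚ.≤ (ℤ.+ l ℚ./ 1)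
  ratio-bound ε ε>0 n l h = ℚP.≤-trans
    (ℚP.*-monoʳ-≤-nonNeg (ℤ.+ n ℚ./ 1) {{ℚP.normalize-nonNeg n 1}} minus)
    (ℚP.toℚᵘ-cancel-≤ (ℚᵘP.≤-respˡ-≃ (ℚᵘP.≃-sym unnormalised)
      (ℚᵘP.≤-respʳ-≃ (ℚᵘP.≃-sym (ℚP.toℚᵘ-fromℚᵘ (ℚᵘ.mkℚᵘ (ℤ.+ l) 0))) (ℚᵘ.*≤* cross))))
    where
    minus : (ℤ.+ 3 ℚ./ 4) ℚ.- ε ℚ.≤ (ℤ.+ 3 ℚ./ 4)
    minus = ℚP.≤-trans (ℚP.+-monoʳ-≤ (ℤ.+ 3 ℚ./ 4) (ℚP.neg-antimono-≤ (ℚP.<⇒≤ (ℚP.positive⁻¹ ε {{ε>0}}))))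
      (ℚP.≤-reflexive (ℚP.+-identityʳ (ℤ.+ 3 ℚ./ 4)))
    unnormalised : ℚ.toℚᵘ ((ℤ.+ 3 ℚ./ 4) ℚ.* (ℤ.+ n ℚ./ 1)) ℚᵘ.≃ ℚᵘ.mkℚᵘ (ℤ.+ 3) 3 ℚᵘ.* ℚᵘ.mkℚᵘ (ℤ.+ n) 0
    unnormalised = ℚᵘP.≃-trans (ℚP.toℚᵘ-homo-* (ℤ.+ 3 ℚ./ 4) (ℤ.+ n ℚ./ 1))
      (ℚᵘP.*-congˡ {ℚᵘ.mkℚᵘ (ℤ.+ 3) 3} (ℚP.toℚᵘ-fromℚᵘ (ℚᵘ.mkℚᵘ (ℤ.+ n) 0)))
    cross : (ℤ.+ 3 ℤ.* ℤ.+ n) ℤ.* ℤ.+ 1 ℤ.≤ ℤ.+ l ℤ.* ℤ.+ 4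
    cross = subst₂ ℤ._≤_ (sym (trans (ℤP.*-identityʳ (ℤ.+ 3 ℤ.* ℤ.+ n)) (sym (ℤP.pos-* 3 n))))
      (trans (ℤP.pos-* 4 l) (ℤP.*-comm (ℤ.+ 4) (ℤ.+ l))) (ℤ.+≤+ h)

open LongRainbowPath using (threshold; rainbow-path; ratio-bound)
open import Data.Nat using (ℕ; _>_)
open import Data.Fin using (Fin)
open import Data.List using (List; length)
open import Data.Product using (Σ; _×_; _,_)
open import Data.Rational using (ℚ; _-_; _*_; _≤_; Positive)
open import Data.Rational using () renaming (_/_ to _÷_)
open import Data.Integer using (+_)

theorem3 : (ε : ℚ) → Positive ε →
    Σ ℕ λ n₀ → (n : ℕ) → n > n₀ →
    (c : Fin n → Fin n → ℕ) → IsEdgeColoring n c → IsProper n c →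
    Σ (List (Fin n)) λ p → IsRainbowPath c p ×
    (((+ 3 ÷ 4) - ε) * (+ n ÷ 1) ≤ (+ length p ÷ 1))
theorem3 ε ε>0 = threshold , λ n n>n₀ c symmetric proper →
  let (p , rainbow , enough) = rainbow-path n>n₀ c symmetric proper
  in p , rainbow , ratio-bound ε ε>0 n (length p) enough
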